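{- There exists a randomized algorithm that, given integers $d,n,k\ge 1$ and a matrix $A\in\{0,1\}^{d\times n}$, uses runtime $O\bigl(d\,k\cdot n^{\lceil k/2\rceil}\bigr)$ and satisfies the following: (i) if $A$ has Kruskal rank less than $k$ over $GF(2)$, then the algorithm reports that $A$ has Kruskal rank less than $k$; (ii) if $A$ has Kruskal rank at least $k$ over $GF(2)$, then with probability at least $0.99$ the algorithm reports that $A$ has Kruskal rank at least $k$.
   Context: The Kruskal rank of a matrix $A$ over a field $F$ is the largest integer $r$ such that every set of $r$ columns of $A$ (columns indexed by $\{1,\dots,n\}$) is linearly independent over $F$. Here the entries $0,1$ of $A$ are regarded as elements of $GF(2)=\mathbb{F}_2$. The algorithm outputs one of the two reports "Kruskal rank less than $k$" or "Kruskal rank at least $k$", and probability is over its internal randomness. Runtime convention: the algorithm may use a uniformly random hash function $h:\mathbb{F}_2^d\to\{1,\dots,b\}$ and a hash table with $b$ buckets, and processing one column combination in $\mathbb{F}_2^d$ (forming it, evaluating $h$ on it, and accessing its bucket) is counted as $O(d)$ time. The constant in $O(\cdot)$ is absolute. -}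

module Defs where

open import Data.Bool using (if_then_else_)
open import Data.Fin using (Fin; toℕ)
open import Data.Fin.Properties using (toℕ-injective)
open import Data.Fin.Subset using (Subset; ∣_∣; _∉_)
open import Data.Integer using (+_)
open import Data.List using (List; []; _∷_; map; allFin; length; filter; cartesianProductWith)
open import Data.Maybe using (Maybe; just; nothing)
open import Data.Nat using (ℕ; zero; suc; _+_; _∸_; _≤_; _<_; _≟_; NonZero)
open import Data.Parity using (Parity; 0ℙ; 1ℙ)
import Data.Parity as ℙ
open import Data.Product using (_×_; _,_; ∃-syntax)
open import Data.Rational.Unnormalised using (ℚᵘ; _/_)
open import Data.Vec as Vec using (Vec; []; _∷_; lookup)
open import Function using (_∘_)
open import Level using (Level)
open import Relation.Binary.Definitions using (DecidableEquality)
open import Relation.Binary.PropositionalEquality using (_≡_; _≢_; refl; sym; trans; cong)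
open import Relation.Nullary using (does; yes; no; contradiction)
open import Relation.Unary using (Pred; Decidable)

------------------------------------------------------------------------
-- Linear algebra over GF(2), the two-element field Parity

Column : ℕ → Set
Column d = Vec Parity d

𝟎 : ∀ {d} → Column d
𝟎 = Vec.replicate _ 0ℙ

infixl 6 _⊕_

_⊕_ : ∀ {d} → Column d → Column d → Column d
_⊕_ = Vec.zipWith ℙ._+_

-- A d × n matrix, given by its n columns.
Matrix : ℕ → ℕ → Set
Matrix d n = Vec (Column d) n

linearCombination : ∀ {d n} → Vec Parity n → Matrix d n → Column d
linearCombination []       []       = 𝟎
linearCombination (c ∷ cs) (v ∷ vs) = Vec.map (c ℙ.*_) v ⊕ linearCombination cs vs

-- The columns with index in S; equal columns with different indices count
-- as different members of the family.
LinearlyIndependent : ∀ {d n} → Matrix d n → Subset n → Set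
LinearlyIndependent {n = n} A S =
  (c : Vec Parity n) → (∀ j → j ∉ S → lookup c j ≡ 0ℙ) →
  linearCombination c A ≡ 𝟎 → ∀ j → lookup c j ≡ 0ℙ

AllIndependent : ∀ {d n} → Matrix d n → ℕ → Set
AllIndependent {n = n} A r = (S : Subset n) → ∣ S ∣ ≡ r → LinearlyIndependent A S

-- Only r ≤ n is considered: for r > n there is no set of r columns, and
-- AllIndependent A r would hold vacuously.
record IsKruskalRank {d n} (A : Matrix d n) (r : ℕ) : Set where
  field
    bounded     : r ≤ n
    independent : AllIndependent A r
    largest     : ∀ r′ → r′ ≤ n → AllIndependent A r′ → r′ ≤ r

KruskalRankLessThan : ∀ {d n} → Matrix d n → ℕ → Set
KruskalRankLessThan A k = ∃[ r ] IsKruskalRank A r × r < k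

KruskalRankAtLeast : ∀ {d n} → Matrix d n → ℕ → Set
KruskalRankAtLeast A k = ∃[ r ] IsKruskalRank A r × k ≤ r

------------------------------------------------------------------------
-- Programs of a random access machine with number cells (holding elements
-- of ℕ), vector cells (holding elements of GF(2)^d) and a hash table

-- A cell of either memory: `at a` is cell a, `via a` is the cell whose
-- address is the content of number cell a.
data Ref : Set where
  at via : ℕ → Ref

infix 4 _:=_

data Expr : Set where
  lit     : ℕ → Expr
  val     : Ref → Expr
  _∔_ _-̇_ : Ref → Ref → Expr

-- In `addColumn`, `entry` the last arguments are number cells holding
-- indices (counted from 0) into the input matrix. `fetch x v` and
-- `store v x` read and write the bucket of the content of vector cell v.
data Command : Set where
  _:=_         : Ref → Expr → Command
  entry        : Ref → (row column : Ref) → Command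
  clear        : Ref → Command
  addColumn    : (target source column : Ref) → Command
  fetch        : (x v : Ref) → Command
  store        : (v x : Ref) → Command
  skip         : Command
  _⨾_          : Command → Command → Command
  ifNonZero    : Ref → Command → Command → Command
  whileNonZero : Ref → Command → Command

infixr 3 _⨾_

record State (d : ℕ) : Set where
  constructor mkState
  field
    num    : ℕ → ℕ
    vec    : ℕ → Column d
    bucket : ℕ → ℕ

open State public

infixl 9 _[_↦_]

_[_↦_] : ∀ {X : Set} → (ℕ → X) → ℕ → X → ℕ → X
(f [ a ↦ x ]) a′ = if does (a′ ≟ a) then x else f a′

module _ {d : ℕ} where

  address : Ref → State d → ℕ
  address (at a)  s = a
  address (via a) s = num s a

  number : Ref → State d → ℕ
  number x s = num s (address x s)

  vector : Ref → State d → Column d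
  vector v s = vec s (address v s)

  eval : Expr → State d → ℕ
  eval (lit c) s = c
  eval (val y) s = number y s
  eval (y ∔ z) s = number y s + number z s
  eval (y -̇ z) s = number y s ∸ number z s

  setNumber : Ref → ℕ → State d → State d
  setNumber x m s = record s { num = num s [ address x s ↦ m ] }

  setVector : Ref → Column d → State d → State d
  setVector v u s = record s { vec = vec s [ address v s ↦ u ] }

  setBucket : ℕ → ℕ → State d → State d
  setBucket i m s = record s { bucket = bucket s [ i ↦ m ] }

-- Execution ⟨ c , s ⟩⇓[ t ] s′ : running c from state s halts in state s′
-- after time t. Operations on numbers and tests take unit time; addition
-- and subtraction are the only arithmetic. Forming a column combination
-- from another one by adding a column, hashing it, and accessing its
-- bucket take time d each. The hash function is absent before it has been
-- drawn; accessing the table then, or an entry outside the matrix, has no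
-- execution.
module Execution {d n : ℕ} (A : Matrix d n) (hash : Maybe (Column d → ℕ)) where

  infix 2 ⟨_,_⟩⇓[_]_

  data ⟨_,_⟩⇓[_]_ : Command → State d → ℕ → State d → Set where

    assign : ∀ {x e s} → ⟨ x := e , s ⟩⇓[ 1 ] setNumber x (eval e s) s

    entry-0 : ∀ {x y z s} (i : Fin d) (j : Fin n) →
              number y s ≡ toℕ i → number z s ≡ toℕ j →
              lookup (lookup A j) i ≡ 0ℙ →
              ⟨ entry x y z , s ⟩⇓[ 1 ] setNumber x 0 s

    entry-1 : ∀ {x y z s} (i : Fin d) (j : Fin n) →
              number y s ≡ toℕ i → number z s ≡ toℕ j →
              lookup (lookup A j) i ≡ 1ℙ →
              ⟨ entry x y z , s ⟩⇓[ 1 ] setNumber x 1 s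

    clear : ∀ {v s} → ⟨ clear v , s ⟩⇓[ d ] setVector v 𝟎 s

    addColumn : ∀ {v u z s} (j : Fin n) → number z s ≡ toℕ j →
                ⟨ addColumn v u z , s ⟩⇓[ d ] setVector v (vector u s ⊕ lookup A j) s

    fetch : ∀ {x v s h} → hash ≡ just h →
            ⟨ fetch x v , s ⟩⇓[ d + d ] setNumber x (bucket s (h (vector v s))) s

    store : ∀ {v x s h} → hash ≡ just h →
            ⟨ store v x , s ⟩⇓[ d + d ] setBucket (h (vector v s)) (number x s) s

    skip : ∀ {s} → ⟨ skip , s ⟩⇓[ 0 ] s

    seq : ∀ {c c′ s s′ s″ t t′} → ⟨ c , s ⟩⇓[ t ] s′ → ⟨ c′ , s′ ⟩⇓[ t′ ] s″ →
          ⟨ c ⨾ c′ , s ⟩⇓[ t + t′ ] s″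

    if-nonzero : ∀ {x c c′ s s′ t} → number x s ≢ 0 → ⟨ c , s ⟩⇓[ t ] s′ →
                 ⟨ ifNonZero x c c′ , s ⟩⇓[ suc t ] s′

    if-zero : ∀ {x c c′ s s′ t} → number x s ≡ 0 → ⟨ c′ , s ⟩⇓[ t ] s′ →
              ⟨ ifNonZero x c c′ , s ⟩⇓[ suc t ] s′

    while-nonzero : ∀ {x c s s′ s″ t t′} → number x s ≢ 0 → ⟨ c , s ⟩⇓[ t ] s′ →
                    ⟨ whileNonZero x c , s′ ⟩⇓[ t′ ] s″ →
                    ⟨ whileNonZero x c , s ⟩⇓[ suc (t + t′) ] s″

    while-zero : ∀ {x c s} → number x s ≡ 0 → ⟨ whileNonZero x c , s ⟩⇓[ 1 ] s

  -- Time and final state are functions of the program and initial state.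
  deterministic : ∀ {c s s₁ s₂ t₁ t₂} →
                  ⟨ c , s ⟩⇓[ t₁ ] s₁ → ⟨ c , s ⟩⇓[ t₂ ] s₂ → t₁ ≡ t₂ × s₁ ≡ s₂
  deterministic assign assign = refl , refl
  deterministic (entry-0 i j p q e) (entry-0 i′ j′ p′ q′ e′) = refl , refl
  deterministic (entry-1 i j p q e) (entry-1 i′ j′ p′ q′ e′) = refl , refl
  deterministic (entry-0 i j p q e) (entry-1 i′ j′ p′ q′ e′)
    with refl ← toℕ-injective (trans (sym p) p′)
       | refl ← toℕ-injective (trans (sym q) q′)
    = contradiction (trans (sym e) e′) λ ()
  deterministic (entry-1 i j p q e) (entry-0 i′ j′ p′ q′ e′)
    with refl ← toℕ-injective (trans (sym p) p′)
       | refl ← toℕ-injective (trans (sym q) q′)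
    = contradiction (trans (sym e) e′) λ ()
  deterministic clear clear = refl , refl
  deterministic (addColumn j p) (addColumn j′ p′)
    with refl ← toℕ-injective (trans (sym p) p′) = refl , refl
  deterministic (fetch refl) (fetch refl) = refl , refl
  deterministic (store refl) (store refl) = refl , refl
  deterministic skip skip = refl , refl
  deterministic (seq p q) (seq p′ q′)
    with refl , refl ← deterministic p p′
    with refl , refl ← deterministic q q′ = refl , refl
  deterministic (if-nonzero _ p) (if-nonzero _ p′)
    with refl , refl ← deterministic p p′ = refl , refl
  deterministic (if-nonzero x≢0 _) (if-zero x≡0 _) = contradiction x≡0 x≢0
  deterministic (if-zero x≡0 _) (if-nonzero x≢0 _) = contradiction x≡0 x≢0
  deterministic (if-zero _ p) (if-zero _ p′)
    with refl , refl ← deterministic p p′ = refl , refl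
  deterministic (while-nonzero _ p q) (while-nonzero _ p′ q′)
    with refl , refl ← deterministic p p′
    with refl , refl ← deterministic q q′ = refl , refl
  deterministic (while-nonzero x≢0 _ _) (while-zero x≡0) = contradiction x≡0 x≢0
  deterministic (while-zero x≡0) (while-nonzero x≢0 _ _) = contradiction x≡0 x≢0
  deterministic (while-zero _) (while-zero _) = refl , refl

------------------------------------------------------------------------
-- Hash functions and probability

HashFunction : ℕ → ℕ → Set
HashFunction d b = Column d → Fin b

-- Every function GF(2)^d → Fin b, exactly once up to pointwise equality.
hashFunctions : ∀ d b → List (HashFunction d b)
hashFunctions zero    b = map (λ i _ → i) (allFin b)
hashFunctions (suc d) b = cartesianProductWith split (hashFunctions d b) (hashFunctions d b)
  where
  split : HashFunction d b → HashFunction d b → HashFunction (suc d) b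
  split h₀ h₁ (0ℙ ∷ v) = h₀ v
  split h₀ h₁ (1ℙ ∷ v) = h₁ v

hashFunctions-nonEmpty : ∀ d b → .{{NonZero b}} → NonZero (length (hashFunctions d b))
hashFunctions-nonEmpty zero    (suc b) = _
hashFunctions-nonEmpty (suc d) b
  with hashFunctions d b | hashFunctions-nonEmpty d b
... | _ ∷ _ | _ = _

Probability : ∀ {d b : ℕ} {p : Level} .{{_ : NonZero b}} {P : Pred (HashFunction d b) p} →
              Decidable P → ℚᵘ
Probability {d} {b} P? =
  (+ length (filter P? hs) / length hs) {{hashFunctions-nonEmpty d b}}
  where hs = hashFunctions d b

------------------------------------------------------------------------
-- Randomized algorithms

data Report : Set where
  rank<k rank≥k : Report

_≟ᴿ_ : DecidableEquality Report
rank<k ≟ᴿ rank<k = yes refl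
rank<k ≟ᴿ rank≥k = no λ ()
rank≥k ≟ᴿ rank<k = no λ ()
rank≥k ≟ᴿ rank≥k = yes refl

-- `setup` is run first and determines the number b of buckets; then a hash
-- function with b values is drawn and `main` is run, on a table whose buckets
-- all contain 0; creating this table is not charged.
record Algorithm : Set where
  field
    setup main : Command

initial : ∀ d → ℕ → ℕ → State d
initial d n k = mkState input (λ _ → 𝟎) (λ _ → 0)
  where
  input : ℕ → ℕ
  input 1 = d
  input 2 = n
  input 3 = k
  input _ = 0

report : ∀ {d} → State d → Report
report s with num s 0
... | zero  = rank<k
... | suc _ = rank≥k

-- The (unique) behaviour of an algorithm on one input: it halts for every
-- hash function that may be drawn, and `time`, `outcome` give its total
-- running time and its report as random variables.
record Behaviour (𝒜 : Algorithm) {d n} (k : ℕ) (A : Matrix d n) : Set where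
  open Algorithm 𝒜
  field
    setupTime : ℕ
    afterSetup : State d
    runSetup : let open Execution A nothing in
               ⟨ setup , initial d n k ⟩⇓[ setupTime ] afterSetup

  buckets : ℕ
  buckets = num afterSetup 0

  field
    {{buckets-nonZero}} : NonZero buckets
    mainTime : HashFunction d buckets → ℕ
    final : HashFunction d buckets → State d
    runMain : (h : HashFunction d buckets) →
              let open Execution A (just (toℕ ∘ h)) in
              ⟨ main , afterSetup ⟩⇓[ mainTime h ] final h

  time : HashFunction d buckets → ℕ
  time h = setupTime + mainTime h

  outcome : HashFunction d buckets → Report
  outcome h = report (final h)

{-# OPTIONS --safe #-}

-- A linear dependency of at most k columns is the same as two distinct column
-- sets S, T with |S| ≤ ⌈k/2⌉, |T| ≤ ⌊k/2⌋ and equal column sums. A depth-first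
-- search first enters the sums of all sets T with |T| ≤ ⌊k/2⌋ in the hash table
-- and reports any hit on an occupied bucket; a second search over the sets S
-- with |S| ≤ ⌈k/2⌉ reports any hit of an S with |S| > ⌊k/2⌋. A dependency always
-- produces a hit. Conversely, without a dependency the sums are distinct, so
-- there is no hit as soon as the hash function is injective; with 128 · 4^d
-- buckets this fails with probability at most 1/128, by the union bound over all
-- pairs of vectors. There are at most 1 + r n^r sets of size at most r.
module Submission where

open import Defs
open import Data.Bool using (true; false; if_then_else_)
open import Data.Empty using (⊥; ⊥-elim)
open import Data.Fin as Fin using (Fin; zero; suc; toℕ; fromℕ<)
open import Data.Fin.Properties using (toℕ-injective; toℕ-fromℕ<)
open import Data.Fin.Subset using (Subset; _∉_; ∣_∣)
open import Data.Fin.Subset.Properties using (drop-there)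
open import Data.Integer using (+_)
import Data.Integer as ℤ
import Data.Integer.Properties as ℤ
open import Data.List
  using (List; []; _∷_; _++_; foldl; length; map; filter; allFin; tabulate; cartesianProductWith)
open import Data.List.Membership.Propositional using (_∈_)
open import Data.List.Membership.Propositional.Properties using (∈-map⁺; ∈-map⁻; ∈-++⁺ˡ; ∈-++⁺ʳ)
open import Data.List.Properties
  using (foldl-++; length-++; length-map; length-tabulate; map-++; map-∘; map-cong; map-tabulate)
open import Data.List.Relation.Unary.All as All using (All; []; _∷_)
import Data.List.Relation.Unary.All.Properties as All
open import Data.List.Relation.Unary.AllPairs using (AllPairs; []; _∷_)
import Data.List.Relation.Unary.AllPairs.Properties as AllPairs
open import Data.List.Relation.Unary.Any using (here; there)
open import Data.List.Relation.Unary.Unique.Propositional using (Unique)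
import Data.List.Relation.Unary.Unique.Propositional.Properties as Unique
open import Data.Maybe using (Maybe; just; nothing)
open import Data.Nat hiding (_/_)
open import Data.Nat.ListAction using (sum)
open import Data.Nat.ListAction.Properties using (sum-++)
open import Data.Nat.Properties
open import Algebra.Properties.CommutativeSemigroup *-commutativeSemigroup using (x∙yz≈y∙xz)
open import Data.Nat.Tactic.RingSolver using (solve-∀)
open import Data.Parity using (Parity; 0ℙ; 1ℙ)
import Data.Parity as ℙ
import Data.Parity.Properties as ℙ
open import Data.Product using (Σ-syntax; ∃-syntax; _×_; _,_; proj₁; proj₂)
open import Data.Rational.Unnormalised using (_/_; *≤*) renaming (_≤_ to _≤ℚ_)
open import Data.Sum using (_⊎_; inj₁; inj₂)
open import Data.Unit using (⊤)
open import Data.Vec as Vec using (Vec; []; _∷_; lookup)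
open import Data.Vec.Properties as Vec
  using (zipWith-assoc; zipWith-comm; zipWith-identityˡ; zipWith-identityʳ;
         map-id; map-const; ∷-injectiveʳ; ≡-dec)
open import Function using (_∘_)
open import Relation.Binary.PropositionalEquality
open import Relation.Nullary using (Dec; does; yes; no; ¬_; contradiction)
open import Relation.Nullary.Decidable using (dec-true; dec-false)
open import Relation.Unary using (Pred; Decidable)

-- Executions up to pointwise equality of states

-- A bucket stores only whether it is occupied, never a vector, and this causes the one-sided error.
-- Equal sums share a bucket under every hash function, so acceptance always certifies independence.
-- The converse fails if two different sums collide; asking for injectivity on all of GF(2)^d makes
-- the good event independent of the matrix. Buckets are not charged, so 128 · 4^d of them cost only
-- the time to compute that number, and 128 is chosen because 127/128 ≥ 99/100.
--
-- The time bound leaves O(d) per visited set, too little to form a sum of up to k columns afresh.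
-- Over GF(2) adding a column a second time removes it, so one vector cell, changed by one addition
-- on the way down and one on the way back, serves the whole search.
--
-- Machine and algebra meet in the list `nodes`: the program is shown to compute two folds over it,
-- while completeness, absence of repetitions and length are proved for the coefficient vectors that
-- it enumerates.

update-cong : ∀ {X : Set} {f g : ℕ → X} {a b x y} →
              f ≗ g → a ≡ b → x ≡ y → (f [ a ↦ x ]) ≗ (g [ b ↦ y ])
update-cong {a = a} {x = x} f≗g refl refl c =
  cong (λ z → if does (c ≟ a) then x else z) (f≗g c)

module _ {d : ℕ} where

  infix 4 _≈_

  record _≈_ (s s′ : State d) : Set where
    constructor agree
    field
      num≗    : num s ≗ num s′
      vec≗    : vec s ≗ vec s′
      bucket≗ : bucket s ≗ bucket s′

  open _≈_ public

  ≈-refl : ∀ {s} → s ≈ s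
  ≈-refl = agree (λ _ → refl) (λ _ → refl) (λ _ → refl)

  ≈-sym : ∀ {s s′} → s ≈ s′ → s′ ≈ s
  ≈-sym (agree p q r) = agree (sym ∘ p) (sym ∘ q) (sym ∘ r)

  ≈-trans : ∀ {s s′ s″} → s ≈ s′ → s′ ≈ s″ → s ≈ s″
  ≈-trans (agree p q r) (agree p′ q′ r′) =
    agree (λ a → trans (p a) (p′ a)) (λ a → trans (q a) (q′ a)) (λ a → trans (r a) (r′ a))

  module _ {s s′ : State d} (e : s ≈ s′) where

    address-cong : ∀ x → address x s ≡ address x s′
    address-cong (at a)  = refl
    address-cong (via a) = num≗ e a

    number-cong : ∀ x → number x s ≡ number x s′
    number-cong x = trans (num≗ e _) (cong (num s′) (address-cong x))

    vector-cong : ∀ x → vector x s ≡ vector x s′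
    vector-cong x = trans (vec≗ e _) (cong (vec s′) (address-cong x))

    eval-cong : ∀ x → eval x s ≡ eval x s′
    eval-cong (lit c) = refl
    eval-cong (val y) = number-cong y
    eval-cong (y ∔ z) = cong₂ _+_ (number-cong y) (number-cong z)
    eval-cong (y -̇ z) = cong₂ _∸_ (number-cong y) (number-cong z)

    setNumber-cong : ∀ x {m m′} → m ≡ m′ → setNumber x m s ≈ setNumber x m′ s′
    setNumber-cong x p = agree (update-cong (num≗ e) (address-cong x) p) (vec≗ e) (bucket≗ e)

    setVector-cong : ∀ x {u u′} → u ≡ u′ → setVector x u s ≈ setVector x u′ s′
    setVector-cong x p = agree (num≗ e) (update-cong (vec≗ e) (address-cong x) p) (bucket≗ e)

    setBucket-cong : ∀ {i i′ m m′} → i ≡ i′ → m ≡ m′ → setBucket i m s ≈ setBucket i′ m′ s′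
    setBucket-cong p q = agree (num≗ e) (vec≗ e) (update-cong (bucket≗ e) p q)

-- Total in the index, so that `effect` below can be defined without a bound on it; `Executable`
-- demands an index below n, which excludes the default 𝟎.
column : ∀ {d n} → Matrix d n → ℕ → Column d
column []      i       = 𝟎
column (v ∷ A) zero    = v
column (v ∷ A) (suc i) = column A i

lookup-column : ∀ {d n} (A : Matrix d n) {i} (i<n : i < n) → lookup A (fromℕ< i<n) ≡ column A i
lookup-column (v ∷ A) {zero}  i<n = refl
lookup-column (v ∷ A) {suc i} i<n = lookup-column A (s<s⁻¹ i<n)

module Running {d n : ℕ} (A : Matrix d n) (hash : Maybe (Column d → ℕ)) where

  open Execution A hash public

  -- A command inspects a state only at single addresses, so pointwise equal states take the same
  -- branches in the same time.
  run-cong : ∀ {c s s′ r t} → ⟨ c , s ⟩⇓[ t ] r → s ≈ s′ →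
             Σ[ r′ ∈ State d ] (⟨ c , s′ ⟩⇓[ t ] r′) × r ≈ r′
  run-cong (assign {x} {f}) e = _ , assign , setNumber-cong e x (eval-cong e f)
  run-cong (entry-0 {x} {y} {z} i j p q l) e =
    _ , entry-0 i j (trans (sym (number-cong e y)) p) (trans (sym (number-cong e z)) q) l ,
    setNumber-cong e x refl
  run-cong (entry-1 {x} {y} {z} i j p q l) e =
    _ , entry-1 i j (trans (sym (number-cong e y)) p) (trans (sym (number-cong e z)) q) l ,
    setNumber-cong e x refl
  run-cong (clear {v}) e = _ , clear , setVector-cong e v refl
  run-cong (addColumn {v} {u} {z} j p) e =
    _ , addColumn j (trans (sym (number-cong e z)) p) ,
    setVector-cong e v (cong (_⊕ lookup A j) (vector-cong e u))
  run-cong {s′ = s′} (fetch {x} {v} {h = h} p) e =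
    _ , fetch p ,
    setNumber-cong e x (trans (bucket≗ e _) (cong (λ u → bucket s′ (h u)) (vector-cong e v)))
  run-cong (store {v} {x} {h = h} p) e =
    _ , store p , setBucket-cong e (cong h (vector-cong e v)) (number-cong e x)
  run-cong skip e = _ , skip , e
  run-cong (seq p q) e with _ , p′ , e′ ← run-cong p e with _ , q′ , e″ ← run-cong q e′ =
    _ , seq p′ q′ , e″
  run-cong (if-nonzero {x} x≢0 p) e with _ , p′ , e′ ← run-cong p e =
    _ , if-nonzero (x≢0 ∘ trans (number-cong e x)) p′ , e′
  run-cong (if-zero {x} x≡0 p) e with _ , p′ , e′ ← run-cong p e =
    _ , if-zero (trans (sym (number-cong e x)) x≡0) p′ , e′
  run-cong (while-nonzero {x} x≢0 p q) e
    with _ , p′ , e′ ← run-cong p e with _ , q′ , e″ ← run-cong q e′ =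
    _ , while-nonzero (x≢0 ∘ trans (number-cong e x)) p′ q′ , e″
  run-cong (while-zero {x} x≡0) e = _ , while-zero (trans (sym (number-cong e x)) x≡0) , e

  -- Function extensionality is not available, so the final state is only
  -- described up to _≈_.
  record Run (c : Command) (s : State d) (T : ℕ) (Q : State d → Set) : Set where
    constructor run
    field
      {duration}    : ℕ
      {reached}     : State d
      {described}   : State d
      execution     : ⟨ c , s ⟩⇓[ duration ] reached
      duration≤     : duration ≤ T
      reached≈      : reached ≈ described
      postcondition : Q described

  Reach : Command → State d → ℕ → State d → Set
  Reach c s T s′ = Run c s T (s′ ≡_)

  redescribe : ∀ {c s T s′ s″} → s′ ≡ s″ → Reach c s T s′ → Reach c s T s″
  redescribe refl r = r

  Run-≤ : ∀ {c s T T′ Q} → T ≤ T′ → Run c s T Q → Run c s T′ Q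
  Run-≤ T≤T′ (run x t e q) = run x (≤-trans t T≤T′) e q

  Run-≈ : ∀ {c s s′ T Q} → s ≈ s′ → Run c s T Q → Run c s′ T Q
  Run-≈ e (run x t e′ q) with _ , y , f ← run-cong x e = run y t (≈-trans (≈-sym f) e′) q

  bind : ∀ {c c′ s T T′ P Q} → Run c s T P → (∀ {s′} → P s′ → Run c′ s′ T′ Q) →
         Run (c ⨾ c′) s (T + T′) Q
  bind (run x t e p) κ with run x′ t′ e′ q ← Run-≈ (≈-sym e) (κ p) =
    run (seq x x′) (+-mono-≤ t t′) e′ q

  infixr 4 _then_

  _then_ : ∀ {c c′ s s′ T T′ Q} → Reach c s T s′ → Run c′ s′ T′ Q → Run (c ⨾ c′) s (T + T′) Q
  r then r′ = bind r λ {refl → r′}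

  while-step : ∀ {x c s s′ T T′ Q} → number x s ≢ 0 → Reach c s T s′ →
               Run (whileNonZero x c) s′ T′ Q → Run (whileNonZero x c) s (suc (T + T′)) Q
  while-step x≢0 (run x t e refl) r with run x′ t′ e′ q ← Run-≈ (≈-sym e) r =
    run (while-nonzero x≢0 x x′) (s≤s (+-mono-≤ t t′)) e′ q

  while-stop : ∀ {x c s Q} → number x s ≡ 0 → Q s → Run (whileNonZero x c) s 1 Q
  while-stop x≡0 q = run (while-zero x≡0) ≤-refl ≈-refl q

  module Straight (h : Column d → ℕ) where

    -- A symbolic interpreter for straight-line code. On a concrete program `effect` and `cost`
    -- compute, so verifying a block amounts to comparing two explicit states, and most components
    -- of `Executable` become the unit type.
    effect : Command → State d → State d
    effect (x := e)          s = setNumber x (eval e s) s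
    effect (clear v)         s = setVector v 𝟎 s
    effect (addColumn v u z) s = setVector v (vector u s ⊕ column A (number z s)) s
    effect (fetch x v)       s = setNumber x (bucket s (h (vector v s))) s
    effect (store v x)       s = setBucket (h (vector v s)) (number x s) s
    effect (c ⨾ c′)          s = effect c′ (effect c s)
    effect _                 s = s

    cost : Command → ℕ
    cost (x := e)          = 1
    cost (clear v)         = d
    cost (addColumn v u z) = d
    cost (fetch x v)       = d + d
    cost (store v x)       = d + d
    cost (c ⨾ c′)          = cost c + cost c′
    cost _                 = 0

    -- In particular c contains neither a branch nor a loop.
    Executable : Command → State d → Set
    Executable (x := e)          s = ⊤
    Executable (clear v)         s = ⊤
    Executable (addColumn v u z) s = number z s < n
    Executable (fetch x v)       s = hash ≡ just h
    Executable (store v x)       s = hash ≡ just h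
    Executable skip              s = ⊤
    Executable (c ⨾ c′)          s = Executable c s × Executable c′ (effect c s)
    Executable _                 s = ⊥

    execute : ∀ c s → Executable c s → ⟨ c , s ⟩⇓[ cost c ] effect c s
    execute (x := e)          s p = assign
    execute (clear v)         s p = clear
    execute (addColumn v u z) s p =
      subst (λ w → ⟨ addColumn v u z , s ⟩⇓[ d ] setVector v (vector u s ⊕ w) s) (lookup-column A p)
        (addColumn (fromℕ< p) (sym (toℕ-fromℕ< p)))
    execute (fetch x v)       s p = fetch p
    execute (store v x)       s p = store p
    execute skip              s p = skip
    execute (c ⨾ c′)          s (p , q) = seq (execute c s p) (execute c′ (effect c s) q)

    straight : ∀ {c s s′} → Executable c s → effect c s ≈ s′ → Reach c s (cost c) s′
    straight p e = run (execute _ _ p) ≤-refl e refl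

  branch-nonzero : ∀ {x c c′ s T Q} → number x s ≢ 0 → Run c s T Q →
                   Run (ifNonZero x c c′) s (suc T) Q
  branch-nonzero x≢0 (run x t e q) = run (if-nonzero x≢0 x) (s≤s t) e q

  branch-zero : ∀ {x c c′ s T Q} → number x s ≡ 0 → Run c′ s T Q →
                Run (ifNonZero x c c′) s (suc T) Q
  branch-zero x≡0 (run x t e q) = run (if-zero x≡0 x) (s≤s t) e q

-- The algorithm

-- lower and upper hold ⌊k/2⌋ and ⌈k/2⌉. During a search, the currently chosen
-- columns have increasing indices, and vector cell 0 holds their sum. When i
-- columns are chosen, ptr holds 13 + i, room the number of columns that may
-- still be added, and cell 13 + i the number c of columns not yet tried as the
-- next one: those with indices n ∸ c, …, n ∸ 1. So the chosen columns can be
-- recomputed from cells 13, …, 12 + i when backtracking. The cell flag is set to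
-- 0 on a hit; its initial value suc n ∸ k is 0 if k > n.
pattern flag  = at 0
pattern rows  = at 1
pattern cols  = at 2
pattern bound = at 3
pattern upper = at 4
pattern one   = at 5
pattern lower = at 6
pattern ptr   = at 7
pattern top   = via 7
pattern room  = at 8
pattern base  = at 9
pattern tmp   = at 10
pattern rest  = at 11
pattern guard = at 12
pattern cur   = at 0

lookUp insert query descend setGuard pop : Command

lookUp = fetch tmp cur ⨾ ifNonZero tmp (flag := lit 0) skip

insert = lookUp ⨾ store cur one ⨾ tmp := lit 0

query = (tmp := ptr -̇ base ⨾ tmp := tmp -̇ lower) ⨾ ifNonZero tmp lookUp skip ⨾ tmp := lit 0

-- On entering a node the candidates are the columns after the last chosen one, or none if no room
-- is left. The search routines clear `tmp` and `rest` after use, which keeps the state between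
-- iterations in one standard form.
descend = ifNonZero room (top := val rest) (top := lit 0) ⨾ rest := lit 0

-- One cell serves as loop condition: depth plus number of candidates vanishes only at the root with
-- nothing left to try.
setGuard = guard := ptr -̇ base ⨾ guard := guard ∔ top

-- The column is cancelled by adding it again. Its counter is lowered only now, so during the visit
-- of the subtree it still encodes the chosen column.
pop = ptr := ptr -̇ one ⨾ room := one ∔ room ⨾ tmp := cols -̇ top ⨾
      addColumn cur cur tmp ⨾ top := top -̇ one ⨾ tmp := lit 0

forward : Command
forward = tmp := cols -̇ top ⨾ addColumn cur cur tmp ⨾ rest := top -̇ one ⨾
          ptr := one ∔ ptr ⨾ room := room -̇ one ⨾ tmp := lit 0

push visitAll : Command → Command
push p = forward ⨾ p ⨾ descend

visitAll p = whileNonZero guard (ifNonZero top (push p) pop ⨾ setGuard)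

walk : Command → Command
walk p = (rest := val cols ⨾ clear cur) ⨾ p ⨾ descend ⨾ setGuard ⨾ visitAll p

halve quadruple initialise setupProgram mainProgram : Command

-- Division is replaced by counting: when j grows by 1, the pair (⌊j/2⌋, ⌈j/2⌉) becomes (⌈j/2⌉,
-- ⌊j/2⌋ + 1).
halve = rest := val upper ⨾ upper := one ∔ lower ⨾ lower := val rest ⨾ rest := lit 0 ⨾
        tmp := tmp -̇ one

quadruple = flag := flag ∔ flag ⨾ flag := flag ∔ flag ⨾ upper := upper -̇ one

initialise = ptr := lit 13 ⨾ base := lit 13 ⨾ rest := one ∔ cols ⨾ flag := rest -̇ bound ⨾
             clear cur

setupProgram = (flag := lit 128 ⨾ one := lit 1 ⨾ upper := val rows) ⨾
               whileNonZero upper quadruple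

mainProgram = tmp := val bound ⨾ whileNonZero tmp halve ⨾ initialise ⨾
  (room := val lower ⨾ walk insert) ⨾ (room := val upper ⨾ walk query)

layout : List ℕ → (ℕ → ℕ) → ℕ → ℕ
layout []       D a       = D a
layout (x ∷ xs) D zero    = x
layout (x ∷ xs) D (suc a) = layout xs D a

-- On a literal list this unfolds to one equation per register and a pointwise equation for the
-- stack; for a concrete block most of them hold by `refl`.
Agrees : (ℕ → ℕ) → List ℕ → (ℕ → ℕ) → Set
Agrees f []       D = f ≗ D
Agrees f (x ∷ xs) D = f 0 ≡ x × Agrees (f ∘ suc) xs D

layout-≗ : ∀ {f} xs {D} → Agrees f xs D → f ≗ layout xs D
layout-≗ []       p       a       = p a
layout-≗ (x ∷ xs) (p , q) zero    = p
layout-≗ (x ∷ xs) (p , q) (suc a) = layout-≗ xs q a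

-- One refl for each of the 13 registers below the stack.
pattern refls x =
  refl , refl , refl , refl , refl , refl , refl , refl , refl , refl , refl , refl , refl , x

data Suffix {X : Set} : ∀ {m n} → Vec X m → Vec X n → Set where
  here  : ∀ {n} {xs : Vec X n} → Suffix xs xs
  there : ∀ {m n x} {ys : Vec X m} {xs : Vec X n} → Suffix ys xs → Suffix ys (x ∷ xs)

suffix-tail : ∀ {X m n y} {ys : Vec X m} {xs : Vec X n} → Suffix (y ∷ ys) xs → Suffix ys xs
suffix-tail here      = there here
suffix-tail (there p) = there (suffix-tail p)

suffix-length : ∀ {X m n} {ys : Vec X m} {xs : Vec X n} → Suffix ys xs → m ≤ n
suffix-length here      = ≤-refl
suffix-length (there p) = m≤n⇒m≤1+n (suffix-length p)

-- The candidates always form a suffix of the matrix, so their number alone gives the index of the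
-- next column; this is why plain counters suffice as stack entries.
suffix-head : ∀ {d m n} {u : Column d} {us : Matrix d m} {A : Matrix d n} → Suffix (u ∷ us) A →
              n ∸ suc m < n × column A (n ∸ suc m) ≡ u
suffix-head {m = m} here rewrite n∸n≡0 m = z<s , refl
suffix-head (there p) with i<n , q ← suffix-head p
  rewrite +-∸-assoc 1 (suffix-length p) = s<s i<n , q

-- The number of chosen columns and their sum.
Node : ℕ → Set
Node d = ℕ × Column d

-- The cell flag and the hash table.
Store : Set
Store = ℕ × (ℕ → ℕ)

-- The proper descendants of a node in the order in which the loop meets them: the next candidate is
-- chosen, which spends one unit of room, or skipped for good.
tree : ∀ {d c} → ℕ → Column d → ℕ → Matrix d c → List (Node d)
tree i v zero    us       = []
tree i v (suc r) []       = []
tree i v (suc r) (u ∷ us) =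
  (suc i , v ⊕ u) ∷ tree (suc i) (v ⊕ u) r us ++ tree i v (suc r) us

nodes : ∀ {d n} → ℕ → Matrix d n → List (Node d)
nodes r A = (0 , 𝟎) ∷ tree 0 𝟎 r A

check : ℕ → ℕ → ℕ
check zero    x = x
check (suc _) x = 0

-- The first argument will be i ∸ ⌊k/2⌋. Sets of at most ⌊k/2⌋ columns were recorded by the first
-- search and would hit their own entries, so they must not count.
checkLate : ℕ → ℕ → ℕ → ℕ
checkLate zero    y x = x
checkLate (suc _) y x = check y x

recordNode : ∀ {d} → (Column d → ℕ) → Store → Node d → Store
recordNode h (x , b) (i , v) = check (b (h v)) x , b [ h v ↦ 1 ]

queryNode : ∀ {d} → (Column d → ℕ) → ℕ → Store → Node d → Store
queryNode h a (x , b) (i , v) = checkLate (i ∸ a) (b (h v)) x , b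

capacity : ℕ → ℕ → ℕ
capacity zero    c = 0
capacity (suc _) c = c

-- Memory updates and vector addition

update-same : ∀ {X : Set} (f : ℕ → X) a x → (f [ a ↦ x ]) a ≡ x
update-same f a x = cong (λ b → if b then x else f a) (dec-true (a ≟ a) refl)

update-other : ∀ {X : Set} (f : ℕ → X) {a b} x → b ≢ a → (f [ a ↦ x ]) b ≡ f b
update-other f {a} {b} x b≢a = cong (λ c → if c then x else f b) (dec-false (b ≟ a) b≢a)

⊕-assoc : ∀ {d} (u v w : Column d) → u ⊕ v ⊕ w ≡ u ⊕ (v ⊕ w)
⊕-assoc = zipWith-assoc ℙ.+-assoc

⊕-comm : ∀ {d} (u v : Column d) → u ⊕ v ≡ v ⊕ u
⊕-comm = zipWith-comm ℙ.+-comm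

⊕-identityˡ : ∀ {d} (v : Column d) → 𝟎 ⊕ v ≡ v
⊕-identityˡ = zipWith-identityˡ ℙ.+-identityˡ

⊕-identityʳ : ∀ {d} (v : Column d) → v ⊕ 𝟎 ≡ v
⊕-identityʳ = zipWith-identityʳ ℙ.+-identityʳ

⊕-self : ∀ {d} (v : Column d) → v ⊕ v ≡ 𝟎
⊕-self []      = refl
⊕-self (p ∷ v) = cong₂ _∷_ (ℙ.p+p≡0ℙ p) (⊕-self v)

⊕-undo : ∀ {d} (v u : Column d) → v ⊕ u ⊕ u ≡ v
⊕-undo v u = trans (⊕-assoc v u u) (trans (cong (v ⊕_) (⊕-self u)) (⊕-identityʳ v))

-- Correctness and running time of the programs

module Walking {d n : ℕ} (A : Matrix d n) (h : Column d → ℕ) (k m a : ℕ) (1≤d : 1 ≤ d) where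

  open Running A (just h) public
  open Straight h public

  state′ : (t i r c g : ℕ) (D : ℕ → ℕ) (v : Column d) → Store → State d
  state′ t i r c g D v (x , b) =
    mkState (layout (x ∷ d ∷ n ∷ k ∷ m ∷ 1 ∷ a ∷ 13 + i ∷ r ∷ 13 ∷ t ∷ c ∷ g ∷ []) D)
            ((λ _ → 𝟎) [ 0 ↦ v ]) b

  state : (i r c g : ℕ) (D : ℕ → ℕ) (v : Column d) → Store → State d
  state = state′ 0

  vec-reset : ∀ {v w u : Column d} → w ≡ u →
    (((λ _ → 𝟎) [ 0 ↦ v ]) [ 0 ↦ w ]) ≗ ((λ _ → 𝟎) [ 0 ↦ u ])
  vec-reset p zero    = p
  vec-reset p (suc a) = refl

  -- Since d ≥ 1, unit-time steps are absorbed into multiples of d.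
  linear≤ : ∀ c e → c + e * d ≤ (c + e) * d
  linear≤ c e = begin
    c + e * d     ≤⟨ +-monoˡ-≤ (e * d) (m≤m*n c d {{>-nonZero 1≤d}}) ⟩
    c * d + e * d ≡⟨ *-distribʳ-+ d c e ⟨
    (c + e) * d   ∎ where open ≤-Reasoning

  ≤linear : ∀ {t} c e → t ≡ c + e * d → t ≤ (c + e) * d
  ≤linear c e refl = linear≤ c e

  -- The contract of a node routine: its net effect is confined to the flag and the table. The
  -- search is verified once for both routines; 9 d is a common bound for their costs, which are at
  -- most 7 d and 8 d.
  Processes : Command → (Store → Node d → Store) → Set
  Processes p step = ∀ i r c g D v σ →
    Reach p (state i r c g D v σ) (9 * d) (state i r c g D v (step σ (i , v)))

  module _ {p : Command} {step : Store → Node d → Store} (process : Processes p step) where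

    descend-run : ∀ i r c g D v σ →
      Reach descend (state i r c g D v σ) (3 * d) (state i r 0 g (D [ i ↦ capacity r c ]) v σ)
    descend-run i zero c g D v σ = Run-≤ (≤linear 3 0 refl)
      (branch-zero {s = state i 0 c g D v σ} refl
        (straight {s′ = state i 0 c g (D [ i ↦ 0 ]) v σ} _
          (agree (layout-≗ _ (refls λ _ → refl)) (λ _ → refl) (λ _ → refl)))
       then straight _ (agree (layout-≗ _ (refls λ _ → refl)) (λ _ → refl) (λ _ → refl)))
    descend-run i (suc r) c g D v σ = Run-≤ (≤linear 3 0 refl)
      (branch-nonzero {s = state i (suc r) c g D v σ} (λ ())
        (straight {s′ = state i (suc r) c g (D [ i ↦ c ]) v σ} _
          (agree (layout-≗ _ (refls λ _ → refl)) (λ _ → refl) (λ _ → refl)))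
       then straight _ (agree (layout-≗ _ (refls λ _ → refl)) (λ _ → refl) (λ _ → refl)))

    setGuard-run : ∀ i r c g D v σ →
      Reach setGuard (state i r c g D v σ) (2 * d) (state i r c (i + D i) D v σ)
    setGuard-run i r c g D v σ = Run-≤ (≤linear 2 0 refl)
      (straight _ (agree (layout-≗ _ (refls λ _ → refl)) (λ _ → refl) (λ _ → refl)))

    forward-run : ∀ i r {c} g D v σ {u} {us : Matrix d c} → Suffix (u ∷ us) A → D i ≡ suc c →
      Reach forward (state i (suc r) 0 g D v σ) (6 * d) (state (suc i) r c g D (v ⊕ u) σ)
    forward-run i r {c} g D v σ s D≡ with j<n , q ← suffix-head s = Run-≤ (≤linear 5 1 (lemma d))
      (straight (_ , subst (λ e → n ∸ e < n) (sym D≡) j<n , _)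
        (agree (layout-≗ _ (refl , refl , refl , refl , refl , refl , refl , refl , refl , refl , refl ,
                            cong pred D≡ , refl , λ _ → refl))
               (vec-reset (cong (v ⊕_) (trans (cong (λ e → column A (n ∸ e)) D≡) q))) (λ _ → refl)))
      where
      lemma : ∀ d → 1 + (d + (1 + (1 + (1 + 1)))) ≡ 5 + (d + 0)
      lemma = solve-∀

    pop-run : ∀ i r {c} g D v σ {u} {us : Matrix d c} → Suffix (u ∷ us) A → D i ≡ suc c →
      Reach pop (state (suc i) r 0 g D (v ⊕ u) σ) (6 * d) (state i (suc r) 0 g (D [ i ↦ c ]) v σ)
    pop-run i r {c} g D v σ {u} s D≡ with j<n , q ← suffix-head s = Run-≤ (≤linear 5 1 (lemma d))
      (straight (_ , _ , _ , subst (λ e → n ∸ e < n) (sym D≡) j<n , _)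
        (agree (layout-≗ _ (refls (update-cong (λ _ → refl) refl (cong pred D≡))))
               (vec-reset (trans (cong (v ⊕ u ⊕_) (trans (cong (λ e → column A (n ∸ e)) D≡) q))
                 (⊕-undo v u))) (λ _ → refl)))
      where
      lemma : ∀ d → 1 + (1 + (1 + (d + (1 + 1)))) ≡ 5 + (d + 0)
      lemma = solve-∀

    push-run : ∀ i r {c} g D v σ {u} {us : Matrix d c} → Suffix (u ∷ us) A → D i ≡ suc c →
      Reach (push p) (state i (suc r) 0 g D v σ) (6 * d + (9 * d + 3 * d))
            (state (suc i) r 0 g (D [ suc i ↦ capacity r c ]) (v ⊕ u) (step σ (suc i , v ⊕ u)))
    push-run i r g D v σ s D≡ =
      forward-run i r g D v σ s D≡ then process _ _ _ _ _ _ _ then descend-run _ _ _ _ _ _ _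

    -- Stated for an arbitrary continuation, because the search is a single loop:
    -- visiting a subtree is only a segment of its iterations.
    explore : ∀ r {c} (us : Matrix d c) → Suffix us A → ∀ i v σ D {T Q} → D i ≡ capacity r c →
      (∀ D′ → (∀ {q} → q < i → D′ q ≡ D q) → D′ i ≡ 0 →
        Run (visitAll p) (state i r 0 (i + D′ i) D′ v (foldl step σ (tree i v r us))) T Q) →
      Run (visitAll p) (state i r 0 (i + D i) D v σ) (length (tree i v r us) * (32 * d) + T) Q
    explore zero us s i v σ D D≡ κ = κ D (λ _ → refl) D≡
    explore (suc r) [] s i v σ D D≡ κ = κ D (λ _ → refl) D≡
    explore (suc r) {suc c} (u ∷ us) s i v σ D {T} D≡ κ =
      Run-≤ time≤
       (while-step (λ eq → 1+n≢0 (trans (sym D≡) (m+n≡0⇒n≡0 i eq)))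
         (branch-nonzero (1+n≢0 ∘ trans (sym D≡)) (push-run i r _ D v σ s D≡)
           then setGuard-run _ _ _ _ _ _ _)
         (explore r us (suffix-tail s) (suc i) (v ⊕ u) _ _
           (update-same D (suc i) (capacity r c))
           λ D₁ below D₁≡0 →
             -- The subtree has not touched the cells below its own, so the counter of this level
             -- still identifies `u`, the column to be removed.
             let D₁≡ : D₁ i ≡ suc c
                 D₁≡ = trans (below ≤-refl)
                         (trans (update-other D (capacity r c) (<⇒≢ (n<1+n i))) D≡) in
             while-step (λ ())
               (branch-zero D₁≡0 (pop-run i r _ D₁ v _ s D₁≡) then setGuard-run _ _ _ _ _ _ _)
               (explore (suc r) us (suffix-tail s) i v _ _ (update-same D₁ i c)
                 λ D₂ below′ D₂≡0 →
                   subst (λ σ → Run (visitAll p) (state i (suc r) 0 (i + D₂ i) D₂ v σ) T _)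
                     (foldl-++ step (step σ (suc i , v ⊕ u)) (tree (suc i) (v ⊕ u) r us) _)
                     (κ D₂
                       (λ {q} q<i → trans (below′ q<i)
                          (trans (update-other D₁ c (<⇒≢ q<i))
                            (trans (below (m<n⇒m<1+n q<i))
                              (update-other D (capacity r c) (<⇒≢ (m<n⇒m<1+n q<i))))))
                       D₂≡0))))
      where
      open ≤-Reasoning
      X Y : ℕ
      X = length (tree (suc i) (v ⊕ u) r us)
      Y = length (tree i v (suc r) us)
      lemma : ∀ d e X Y T →
              suc (suc (6 * d + (9 * d + 3 * d)) + 2 * d +
                (X * e + suc (suc (6 * d) + 2 * d + (Y * e + T))))
              ≡ (4 + 28 * d) + ((X + Y) * e + T)
      lemma = solve-∀
      -- Each node pays for its own push and pop: 28 d for the commands and 4 for two loop tests and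
      -- two branch tests.
      time≤ = begin
        _                                       ≡⟨ lemma d (32 * d) X Y T ⟩
        (4 + 28 * d) + ((X + Y) * (32 * d) + T) ≤⟨ +-monoˡ-≤ _ (linear≤ 4 28) ⟩
        32 * d + ((X + Y) * (32 * d) + T)       ≡⟨ +-assoc (32 * d) _ T ⟨
        suc (X + Y) * (32 * d) + T
          ≡⟨ cong (λ l → suc l * (32 * d) + T) (length-++ (tree (suc i) (v ⊕ u) r us)) ⟨
        _ ∎

    walk-run : ∀ r c g D v σ {Q} →
      (∀ D′ → Q (state 0 r 0 0 D′ 𝟎 (foldl step σ (nodes r A)))) →
      Run (walk p) (state 0 r c g D v σ) (length (nodes r A) * (32 * d)) Q
    walk-run r c g D v σ {Q} κ =
      Run-≤ time≤
        (Run-≤ (≤linear 1 1 (lemma d))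
           (straight {s = state 0 r c g D v σ} {state 0 r n g D 𝟎 σ} _
             (agree (layout-≗ _ (refls λ _ → refl)) (vec-reset refl) (λ _ → refl)))
         then process 0 r n g D 𝟎 σ
         then descend-run 0 r n g D 𝟎 _
         then setGuard-run _ _ _ _ _ _ _
         then explore r A here 0 𝟎 _ _ (update-same D 0 (capacity r n))
                λ D′ _ D′≡0 →
                  while-stop D′≡0 (subst (λ g → Q (state 0 r 0 g D′ 𝟎 _)) (sym D′≡0) (κ D′)))
      where
      open ≤-Reasoning
      X : ℕ
      X = length (tree 0 𝟎 r A)
      lemma : ∀ d → 1 + d ≡ 1 + (d + 0)
      lemma = solve-∀
      lemma′ : ∀ d e X → 2 * d + (9 * d + (3 * d + (2 * d + (X * e + 1)))) ≡ (1 + 16 * d) + X * e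
      lemma′ = solve-∀
      -- The root is neither pushed nor popped; its 16 d and the final loop test fit into the price
      -- of one node.
      time≤ = begin
        _ ≡⟨ lemma′ d (32 * d) X ⟩
        (1 + 16 * d) + X * (32 * d) ≤⟨ +-monoˡ-≤ _ (linear≤ 1 16) ⟩
        17 * d + X * (32 * d)       ≤⟨ +-monoˡ-≤ _ (*-monoˡ-≤ d (m≤m+n 17 15)) ⟩
        32 * d + X * (32 * d)       ∎

  hit-run : ∀ t i r c g D v x b →
    Reach (ifNonZero tmp (flag := lit 0) skip)
      (state′ t i r c g D v (x , b)) 2 (state′ t i r c g D v (check t x , b))
  hit-run zero    i r c g D v x b = branch-zero refl (run skip z≤n ≈-refl refl)
  hit-run (suc t) i r c g D v x b = branch-nonzero (λ ())
    (straight _ (agree (layout-≗ _ (refls λ _ → refl)) (λ _ → refl) (λ _ → refl)))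

  lookUp-run : ∀ t i r c g D v x b →
    Reach lookUp (state′ t i r c g D v (x , b)) (d + d + 2)
      (state′ (b (h v)) i r c g D v (check (b (h v)) x , b))
  lookUp-run t i r c g D v x b =
    straight {s = state′ t i r c g D v (x , b)} refl
      (agree (layout-≗ _ (refls λ _ → refl)) (λ _ → refl) (λ _ → refl))
    then hit-run (b (h v)) i r c g D v x b

  insert-processes : Processes insert (recordNode h)
  insert-processes i r c g D v (x , b) =
    Run-≤ (≤-trans (≤linear 3 4 (lemma d)) (*-monoˡ-≤ d (m≤n+m 7 2)))
      (lookUp-run 0 i r c g D v x b
       then straight (refl , _) (agree (layout-≗ _ (refls λ _ → refl)) (λ _ → refl) (λ _ → refl)))
    where
    lemma : ∀ d → d + d + 2 + (d + d + 1) ≡ 3 + 4 * d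
    lemma = solve-∀

  query-late : ∀ t i r c g D v x b →
    Reach (ifNonZero tmp lookUp skip ⨾ tmp := lit 0) (state′ t i r c g D v (x , b)) (1 + (d + d + 2) + 1)
      (state i r c g D v (checkLate t (b (h v)) x , b))
  query-late zero    i r c g D v x b =
    Run-≤ (s≤s (m≤n+m 1 (d + d + 2)))
      (branch-zero {s = state i r c g D v (x , b)} {T = 0} refl (run skip z≤n ≈-refl refl)
       then straight _ (agree (layout-≗ _ (refls λ _ → refl)) (λ _ → refl) (λ _ → refl)))
  query-late (suc t) i r c g D v x b =
    branch-nonzero (λ ()) (lookUp-run (suc t) i r c g D v x b)
    then straight _ (agree (layout-≗ _ (refls λ _ → refl)) (λ _ → refl) (λ _ → refl))

  query-processes : Processes query (queryNode h a)
  query-processes i r c g D v (x , b) =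
    Run-≤ (≤-trans (≤linear 6 2 (lemma d)) (*-monoˡ-≤ d (m≤n+m 8 1)))
      (straight {s = state i r c g D v (x , b)} {state′ (i ∸ a) i r c g D v (x , b)} _
         (agree (layout-≗ _ (refls λ _ → refl)) (λ _ → refl) (λ _ → refl))
       then query-late (i ∸ a) i r c g D v x b)
    where
    lemma : ∀ d → 1 + 1 + (1 + (d + d + 2) + 1) ≡ 6 + 2 * d
    lemma = solve-∀

module Setup {d n : ℕ} (A : Matrix d n) (k : ℕ) where

  open Running A nothing
  -- A dummy: no hash function has been drawn yet, and a table access would require `nothing` to
  -- equal `just _`.
  open Straight (λ _ → 0)

  startState : (b m a t : ℕ) → State d
  startState b m a t =
    mkState (layout (b ∷ d ∷ n ∷ k ∷ m ∷ 1 ∷ a ∷ 0 ∷ 0 ∷ 0 ∷ t ∷ 0 ∷ 0 ∷ []) (λ _ → 0))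
            (λ _ → 𝟎) (λ _ → 0)

  quadruple-run : ∀ b t → Reach (whileNonZero upper quadruple)
    (startState b t 0 0) (t * 4 + 1) (startState (b * 4 ^ t) 0 0 0)
  quadruple-run b zero    = while-stop refl (cong (λ b → startState b 0 0 0) (*-identityʳ b))
  quadruple-run b (suc t) = while-step (λ ())
    (straight {s′ = startState (b * 4) t 0 0} _
      (agree (layout-≗ _ (lemma b , refl , refl , refl , refl , refl , refl , refl , refl , refl , refl ,
                          refl , refl , λ _ → refl)) (λ _ → refl) (λ _ → refl)))
    (redescribe (cong (λ b′ → startState b′ 0 0 0) (*-assoc b 4 (4 ^ t))) (quadruple-run (b * 4) t))
    where
    lemma : ∀ b → (b + b) + (b + b) ≡ b * 4
    lemma = solve-∀

  abstract

    setup-run : Reach setupProgram (initial d n k) (3 + (d * 4 + 1)) (startState (128 * 4 ^ d) 0 0 0)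
    setup-run =
      straight {s = initial d n k} {startState 128 d 0 0} _
        (agree (layout-≗ _ (refls λ _ → refl)) (λ _ → refl) (λ _ → refl))
      then quadruple-run 128 d

module Main {d n : ℕ} (A : Matrix d n) (h : Column d → ℕ) (k : ℕ) (1≤d : 1 ≤ d) where

  open Setup A k using (startState)
  open Walking A h k ⌈ k /2⌉ ⌊ k /2⌋ 1≤d

  halve-run : ∀ b t j → Reach (whileNonZero tmp halve)
    (startState b ⌈ j /2⌉ ⌊ j /2⌋ t) (t * 6 + 1) (startState b ⌈ t + j /2⌉ ⌊ t + j /2⌋ 0)
  halve-run b zero    j = while-stop refl refl
  halve-run b (suc t) j = while-step (λ ())
    (straight {s′ = startState b ⌈ suc j /2⌉ ⌊ suc j /2⌋ t} _
      (agree (layout-≗ _ (refls λ _ → refl)) (λ _ → refl) (λ _ → refl)))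
    (redescribe (cong (λ i → startState b ⌈ i /2⌉ ⌊ i /2⌋ 0) (+-suc t j)) (halve-run b t (suc j)))

  records queries : Store
  records = foldl (recordNode h) (suc n ∸ k , λ _ → 0) (nodes ⌊ k /2⌋ A)
  queries = foldl (queryNode h ⌊ k /2⌋) records (nodes ⌈ k /2⌉ A)

  abstract

    main-run : ∀ b → Run mainProgram (startState b 0 0 0)
      (1 + (k * 6 + 1 + ((4 + d) + ((1 + length (nodes ⌊ k /2⌋ A) * (32 * d)) +
        (1 + length (nodes ⌈ k /2⌉ A) * (32 * d))))))
      (λ s → num s 0 ≡ proj₁ queries)
    main-run b =
      straight {s = startState b 0 0 0} {startState b 0 0 k} _
        (agree (layout-≗ _ (refls λ _ → refl)) (λ _ → refl) (λ _ → refl))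
      then redescribe (cong (λ i → startState b ⌈ i /2⌉ ⌊ i /2⌋ 0) (+-identityʳ k)) (halve-run b k 0)
      then straight {s = startState b ⌈ k /2⌉ ⌊ k /2⌋ 0} {started} _
          (agree (layout-≗ _ (refls λ _ → refl)) (λ { zero → refl ; (suc _) → refl }) (λ _ → refl))
      -- The first search leaves unspecified values on the stack; `walk-run` holds for an arbitrary
      -- initial stack.
      then bind {P = λ s → Σ[ D ∈ (ℕ → ℕ) ] s ≡ state 0 ⌊ k /2⌋ 0 0 D 𝟎 records}
        (straight {s = started} {state 0 ⌊ k /2⌋ (1 + n) 0 (λ _ → 0) 𝟎 (suc n ∸ k , λ _ → 0)} _
           (agree (layout-≗ _ (refls λ _ → refl)) (λ _ → refl) (λ _ → refl))
         then walk-run insert-processes ⌊ k /2⌋ (1 + n) 0 (λ _ → 0) 𝟎 _ λ D → D , refl)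
        λ { (D , refl) →
          straight {s = state 0 ⌊ k /2⌋ 0 0 D 𝟎 records} {state 0 ⌈ k /2⌉ 0 0 D 𝟎 records} _
            (agree (layout-≗ _ (refls λ _ → refl)) (λ _ → refl) (λ _ → refl))
          then walk-run query-processes ⌈ k /2⌉ 0 0 D 𝟎 records λ _ → refl }
      where
      started : State d
      started = state 0 0 (1 + n) 0 (λ _ → 0) 𝟎 (suc n ∸ k , λ _ → 0)

-- Linear combinations with few nonzero coefficients

weight : ∀ {n} → Vec Parity n → ℕ
weight []       = 0
weight (0ℙ ∷ x) = weight x
weight (1ℙ ∷ x) = suc (weight x)

weight-𝟎 : ∀ n → weight (𝟎 {n}) ≡ 0
weight-𝟎 zero    = refl
weight-𝟎 (suc n) = weight-𝟎 n

weight≤n : ∀ {n} (x : Vec Parity n) → weight x ≤ n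
weight≤n []       = z≤n
weight≤n (0ℙ ∷ x) = m≤n⇒m≤1+n (weight≤n x)
weight≤n (1ℙ ∷ x) = s≤s (weight≤n x)

weight-⊕ : ∀ {n} (x y : Vec Parity n) → weight (x ⊕ y) ≤ weight x + weight y
weight-⊕ []       []       = z≤n
weight-⊕ (0ℙ ∷ x) (0ℙ ∷ y) = weight-⊕ x y
weight-⊕ (0ℙ ∷ x) (1ℙ ∷ y) = ≤-trans (s≤s (weight-⊕ x y)) (≤-reflexive (sym (+-suc (weight x) (weight y))))
weight-⊕ (1ℙ ∷ x) (0ℙ ∷ y) = s≤s (weight-⊕ x y)
weight-⊕ (1ℙ ∷ x) (1ℙ ∷ y) =
  m≤n⇒m≤1+n (≤-trans (weight-⊕ x y) (+-monoʳ-≤ (weight x) (n≤1+n (weight y))))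

⊕≡𝟎⇒≡ : ∀ {n} {x y : Vec Parity n} → x ⊕ y ≡ 𝟎 → x ≡ y
⊕≡𝟎⇒≡ {x = x} {y} eq = trans (sym (⊕-undo x y)) (trans (cong (_⊕ y) eq) (⊕-identityˡ y))

linearCombination-0∷ : ∀ {d n} (x : Vec Parity n) (v : Column d) A →
  linearCombination (0ℙ ∷ x) (v ∷ A) ≡ linearCombination x A
linearCombination-0∷ x v A =
  trans (cong (_⊕ linearCombination x A) (map-const v 0ℙ)) (⊕-identityˡ _)

linearCombination-1∷ : ∀ {d n} (x : Vec Parity n) (v : Column d) A →
  linearCombination (1ℙ ∷ x) (v ∷ A) ≡ v ⊕ linearCombination x A
linearCombination-1∷ x v A = cong (_⊕ linearCombination x A) (map-id v)

linearCombination-𝟎 : ∀ {d n} (A : Matrix d n) → linearCombination 𝟎 A ≡ 𝟎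
linearCombination-𝟎 []      = refl
linearCombination-𝟎 (v ∷ A) = trans (linearCombination-0∷ 𝟎 v A) (linearCombination-𝟎 A)

⊕-interchange : ∀ {d} (t u v w : Column d) → (t ⊕ u) ⊕ (v ⊕ w) ≡ (t ⊕ v) ⊕ (u ⊕ w)
⊕-interchange t u v w = begin
  (t ⊕ u) ⊕ (v ⊕ w) ≡⟨ ⊕-assoc t u (v ⊕ w) ⟩
  t ⊕ (u ⊕ (v ⊕ w)) ≡⟨ cong (t ⊕_) (⊕-assoc u v w) ⟨
  t ⊕ (u ⊕ v ⊕ w)   ≡⟨ cong (λ z → t ⊕ (z ⊕ w)) (⊕-comm u v) ⟩
  t ⊕ (v ⊕ u ⊕ w)   ≡⟨ cong (t ⊕_) (⊕-assoc v u w) ⟩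
  t ⊕ (v ⊕ (u ⊕ w)) ≡⟨ ⊕-assoc t v (u ⊕ w) ⟨
  (t ⊕ v) ⊕ (u ⊕ w) ∎ where open ≡-Reasoning

map-*-⊕ : ∀ {d} p q (v : Column d) →
  Vec.map ((p ℙ.+ q) ℙ.*_) v ≡ Vec.map (p ℙ.*_) v ⊕ Vec.map (q ℙ.*_) v
map-*-⊕ p q []      = refl
map-*-⊕ p q (r ∷ v) = cong₂ _∷_ (ℙ.*-distribʳ-+ r p q) (map-*-⊕ p q v)

linearCombination-⊕ : ∀ {d n} (x y : Vec Parity n) (A : Matrix d n) →
  linearCombination (x ⊕ y) A ≡ linearCombination x A ⊕ linearCombination y A
linearCombination-⊕ []      []      []      = sym (⊕-self 𝟎)
linearCombination-⊕ (p ∷ x) (q ∷ y) (v ∷ A) =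
  trans (cong₂ _⊕_ (map-*-⊕ p q v) (linearCombination-⊕ x y A)) (⊕-interchange _ _ _ _)

-- Ones are dealt out from the left, to `y` until its budget p is spent and then to `z`.
⊕-split : ∀ {n} (x : Vec Parity n) p q → weight x ≤ p + q →
          Σ[ y ∈ Vec Parity n ] Σ[ z ∈ Vec Parity n ] x ≡ y ⊕ z × weight y ≤ p × weight z ≤ q
⊕-split [] p q w = [] , [] , refl , z≤n , z≤n
⊕-split (0ℙ ∷ x) p q w with y , z , e , wy , wz ← ⊕-split x p q w =
  0ℙ ∷ y , 0ℙ ∷ z , cong (0ℙ ∷_) e , wy , wz
⊕-split (1ℙ ∷ x) (suc p) q (s≤s w) with y , z , e , wy , wz ← ⊕-split x p q w =
  1ℙ ∷ y , 0ℙ ∷ z , cong (1ℙ ∷_) e , s≤s wy , wz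
⊕-split (1ℙ ∷ x) zero (suc q) (s≤s w) with y , z , e , wy , wz ← ⊕-split x 0 q w =
  0ℙ ∷ y , 1ℙ ∷ z , cong (1ℙ ∷_) e , wy , s≤s wz

Supported : ∀ {n} → Vec Parity n → Subset n → Set
Supported x S = ∀ j → j ∉ S → lookup x j ≡ 0ℙ

supported-tail : ∀ {n p b} (x : Vec Parity n) S → Supported (p ∷ x) (b ∷ S) → Supported x S
supported-tail x S s j j∉S = s (suc j) (j∉S ∘ drop-there)

weight-supported : ∀ {n} (x : Vec Parity n) S → Supported x S → weight x ≤ ∣ S ∣
weight-supported []       []          s = z≤n
weight-supported (0ℙ ∷ x) (true ∷ S)  s = m≤n⇒m≤1+n (weight-supported x S (supported-tail x S s))
weight-supported (0ℙ ∷ x) (false ∷ S) s = weight-supported x S (supported-tail x S s)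
weight-supported (1ℙ ∷ x) (true ∷ S)  s = s≤s (weight-supported x S (supported-tail x S s))
weight-supported (1ℙ ∷ x) (false ∷ S) s with () ← s zero (λ ())

-- `AllIndependent` speaks of sets of exactly r columns, so a smaller support must be padded. An
-- index with coefficient 0 is added only when the later indices are too few to reach the required
-- size.
supportingSet : ∀ {n} (x : Vec Parity n) r → weight x ≤ r → r ≤ n →
                Σ[ S ∈ Subset n ] ∣ S ∣ ≡ r × Supported x S
supportingSet [] zero w r≤n = [] , refl , λ ()
supportingSet (1ℙ ∷ x) (suc r) (s≤s w) (s≤s r≤n) with S , e , s ← supportingSet x r w r≤n =
  true ∷ S , cong suc e , λ { zero 0∉ → ⊥-elim (0∉ Vec.here) ; (suc j) j∉ → s j (j∉ ∘ Vec.there) }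
supportingSet (0ℙ ∷ x) zero w r≤n with S , e , s ← supportingSet x 0 w z≤n =
  false ∷ S , e , λ { zero _ → refl ; (suc j) j∉ → s j (j∉ ∘ Vec.there) }
supportingSet {suc n} (0ℙ ∷ x) (suc r) w (s≤s r≤n) with suc r ≤? n
... | yes r<n with S , e , s ← supportingSet x (suc r) w r<n =
  false ∷ S , e , λ { zero _ → refl ; (suc j) j∉ → s j (j∉ ∘ Vec.there) }
... | no r≮n with S , e , s ← supportingSet x r
                   (≤-trans (weight≤n x) (s≤s⁻¹ (≰⇒> r≮n))) r≤n =
  true ∷ S , cong suc e , λ { zero _ → refl ; (suc j) j∉ → s j (j∉ ∘ Vec.there) }

lookup-≡𝟎 : ∀ {n} {x : Vec Parity n} → (∀ j → lookup x j ≡ 0ℙ) → x ≡ 𝟎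
lookup-≡𝟎 {x = []}    p = refl
lookup-≡𝟎 {x = q ∷ x} p = cong₂ _∷_ (p zero) (lookup-≡𝟎 (p ∘ suc))

-- The coefficient vectors enumerated by the search

visits : ℕ → ∀ c → List (Vec Parity c)
visits zero    c       = []
visits (suc r) zero    = []
visits (suc r) (suc c) = map (1ℙ ∷_) (𝟎 ∷ visits r c) ++ map (0ℙ ∷_) (visits (suc r) c)

light : ℕ → ∀ c → List (Vec Parity c)
light r c = 𝟎 ∷ visits r c

-- `visits` follows the recursion of `tree` with coefficient vectors in place of sums; i and v stand
-- for the columns chosen above the subtree.
tree-visits : ∀ {d c} i (v : Column d) r (us : Matrix d c) →
  tree i v r us ≡ map (λ x → i + weight x , v ⊕ linearCombination x us) (visits r c)
tree-visits i v zero    us = refl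
tree-visits i v (suc r) [] = refl
tree-visits {c = suc c} i v (suc r) (u ∷ us) =
  cong₂ _∷_
    (cong₂ _,_ (trans (cong suc (sym (trans (cong (_+_ i) (weight-𝟎 c)) (+-identityʳ i))))
                      (sym (+-suc i (weight (𝟎 {c})))))
               (cong (v ⊕_) (sym (trans (linearCombination-1∷ 𝟎 u us)
                 (trans (cong (u ⊕_) (linearCombination-𝟎 us)) (⊕-identityʳ u))))))
    (trans (cong₂ _++_
      (trans (tree-visits (suc i) (v ⊕ u) r us)
        (trans (map-cong (λ x → cong₂ _,_ (sym (+-suc i (weight x)))
                  (trans (⊕-assoc v u _) (cong (v ⊕_) (sym (linearCombination-1∷ x u us)))))
                 (visits r c))
               (map-∘ (visits r c))))
      (trans (tree-visits i v (suc r) us)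
        (trans (map-cong (λ x → cong (λ w → i + weight x , v ⊕ w) (sym (linearCombination-0∷ x u us)))
                 (visits (suc r) c))
               (map-∘ (visits (suc r) c)))))
      (sym (map-++ _ (map (1ℙ ∷_) (visits r c)) (map (0ℙ ∷_) (visits (suc r) c)))))

nodeOf : ∀ {d n} → Matrix d n → Vec Parity n → Node d
nodeOf A x = weight x , linearCombination x A

nodes-light : ∀ {d n} r (A : Matrix d n) → nodes r A ≡ map (nodeOf A) (light r n)
nodes-light {n = n} r A =
  cong₂ _∷_ (cong₂ _,_ (sym (weight-𝟎 n)) (sym (linearCombination-𝟎 A)))
    (trans (tree-visits 0 𝟎 r A)
      (map-cong (λ x → cong (weight x ,_) (⊕-identityˡ _)) (visits r n)))

visits-weight≤ : ∀ r c → All (λ x → weight x ≤ r) (visits r c)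
visits-weight≤ zero    c       = []
visits-weight≤ (suc r) zero    = []
visits-weight≤ (suc r) (suc c) =
  s≤s (≤-trans (≤-reflexive (weight-𝟎 c)) z≤n) ∷
  All.++⁺ (All.map⁺ (All.map s≤s (visits-weight≤ r c))) (All.map⁺ (visits-weight≤ (suc r) c))

visits-weight> : ∀ r c → All (λ x → 0 < weight x) (visits r c)
visits-weight> zero    c       = []
visits-weight> (suc r) zero    = []
visits-weight> (suc r) (suc c) =
  All.++⁺ (All.map⁺ (All.tabulate {xs = light r c} λ _ → z<s)) (All.map⁺ (visits-weight> (suc r) c))

light-weight : ∀ r c → All (λ x → weight x ≤ r) (light r c)
light-weight r c = ≤-trans (≤-reflexive (weight-𝟎 c)) z≤n ∷ visits-weight≤ r c

𝟎-∉-visits : ∀ r c → All (λ x → 𝟎 ≢ x) (visits r c)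
𝟎-∉-visits r c = All.map (λ { 0<w refl → <⇒≢ 0<w (sym (weight-𝟎 c)) }) (visits-weight> r c)

-- Without repetitions in the enumeration, two nodes with equal sums come from different coefficient
-- vectors and hence reveal a dependency.
visits-unique : ∀ r c → Unique (visits r c)
light-unique : ∀ r c → Unique (light r c)

visits-unique zero    c       = []
visits-unique (suc r) zero    = []
visits-unique (suc r) (suc c) =
  Unique.++⁺ (Unique.map⁺ ∷-injectiveʳ (light-unique r c))
             (Unique.map⁺ ∷-injectiveʳ (visits-unique (suc r) c))
             λ (p , q) → heads (∈-map⁻ _ p) (∈-map⁻ _ q)
  where
  heads : ∀ {x} → (∃[ y ] y ∈ light r c × x ≡ 1ℙ ∷ y) → ¬ (∃[ z ] z ∈ visits (suc r) c × x ≡ 0ℙ ∷ z)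
  heads (_ , _ , refl) (_ , _ , ())

light-unique r c = 𝟎-∉-visits r c ∷ visits-unique r c

∈-light : ∀ {r c} (x : Vec Parity c) → weight x ≤ r → x ∈ light r c
∈-light [] w = here refl
∈-light {r} (0ℙ ∷ x) w with ∈-light x w
... | here refl = here refl
-- The list `visits 0 _` is empty, so the membership `p` forces r to be positive.
... | there p with suc r ← r = there (∈-++⁺ʳ (map (1ℙ ∷_) (light r _)) (∈-map⁺ _ p))
∈-light (1ℙ ∷ x) (s≤s w) = there (∈-++⁺ˡ (∈-map⁺ (1ℙ ∷_) (∈-light x w)))

-- Choosing or skipping the first column is Pascal's rule. After raising 1 and c^r to (c+1)^r, the
-- two branches add up to (r+1)(c+1)^r(1+c). The factor r becomes the k of the time bound.
length-visits : ∀ r c → length (visits r c) ≤ r * c ^ r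
length-visits zero    c       = z≤n
length-visits (suc r) zero    = z≤n
length-visits (suc r) (suc c) = begin
  suc (length (map (1ℙ ∷_) (visits r c) ++ map (0ℙ ∷_) (visits (suc r) c)))
    ≡⟨ cong suc (trans (length-++ (map (1ℙ ∷_) (visits r c)))
         (cong₂ _+_ (length-map _ (visits r c)) (length-map _ (visits (suc r) c)))) ⟩
  suc (length (visits r c)) + length (visits (suc r) c)
    ≤⟨ +-mono-≤ (+-mono-≤ (m^n>0 (suc c) r) (length-visits r c)) (length-visits (suc r) c) ⟩
  suc c ^ r + r * c ^ r + suc r * (c * c ^ r)
    ≤⟨ +-mono-≤ (+-monoʳ-≤ (suc c ^ r) (*-monoʳ-≤ r grow)) (*-monoʳ-≤ (suc r) (*-monoʳ-≤ c grow)) ⟩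
  suc r * suc c ^ r + suc r * (c * suc c ^ r)
    ≡⟨ *-distribˡ-+ (suc r) (suc c ^ r) (c * suc c ^ r) ⟨
  suc r * (suc c * suc c ^ r) ∎
  where
  open ≤-Reasoning
  grow : c ^ r ≤ suc c ^ r
  grow = ^-monoˡ-≤ r (n≤1+n c)

length-nodes : ∀ {d n} r (A : Matrix d n) → length (nodes r A) ≤ suc (r * n ^ r)
length-nodes {n = n} r A = begin
  length (nodes r A)                  ≡⟨ cong length (nodes-light r A) ⟩
  length (map (nodeOf A) (light r n)) ≡⟨ length-map (nodeOf A) (light r n) ⟩
  suc (length (visits r n))           ≤⟨ s≤s (length-visits r n) ⟩
  suc (r * n ^ r)                     ∎
  where open ≤-Reasoning

-- The effect of the two searches on the flag and the hash table

check-≢0 : ∀ y {x} → check y x ≢ 0 → y ≡ 0 × x ≢ 0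
check-≢0 zero    p = refl , p
check-≢0 (suc y) p = contradiction refl p

allPairs-∈ : ∀ {X : Set} {R : X → X → Set} {xs x y} → AllPairs R xs → x ∈ xs → y ∈ xs →
             x ≡ y ⊎ R x y ⊎ R y x
allPairs-∈ (_ ∷ _)  (here refl) (here refl) = inj₁ refl
allPairs-∈ (r ∷ _)  (here refl) (there q)   = inj₂ (inj₁ (All.lookup r q))
allPairs-∈ (r ∷ _)  (there p)   (here refl) = inj₂ (inj₂ (All.lookup r p))
allPairs-∈ (_ ∷ rs) (there p)   (there q)   = allPairs-∈ rs p q

module Tables {d : ℕ} (h : Column d → ℕ) where

  key : Node d → ℕ
  key = h ∘ proj₂

  Apart : Node d → Node d → Set
  Apart u v = key u ≢ key v

  record-all : Store → List (Node d) → Store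
  record-all = foldl (recordNode h)

  record-fresh : ∀ L x b → AllPairs Apart L → All (λ u → b (key u) ≡ 0) L →
    proj₁ (record-all (x , b) L) ≡ x ×
    (∀ y → All (λ u → y ≢ key u) L → proj₂ (record-all (x , b) L) y ≡ b y)
  record-fresh []      x b _ _ = refl , λ _ _ → refl
  record-fresh (u ∷ L) x b (r ∷ rs) (e ∷ es)
    with p , q ← record-fresh L (check (b (key u)) x) (b [ key u ↦ 1 ]) rs
                   (All.zipWith (λ {v} (u≢v , bv≡0) → trans (update-other b {key u} 1 (≢-sym u≢v)) bv≡0) (r , es)) =
    trans p (cong (λ y → check y x) e) ,
    λ { y (y≢u ∷ y≢L) → trans (q y y≢L) (update-other b 1 y≢u) }

  record-mono : ∀ L σ {y} → proj₂ σ y ≢ 0 → proj₂ (record-all σ L) y ≢ 0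
  record-mono []      σ p = p
  record-mono (u ∷ L) (x , b) {y} p = record-mono L _ occupied
    where
    occupied : (b [ key u ↦ 1 ]) y ≢ 0
    occupied with y ≟ key u
    ... | yes refl = λ q → 1+n≢0 (trans (sym (update-same b y 1)) q)
    ... | no y≢u = λ q → p (trans (sym (update-other b 1 y≢u)) q)

  record-occupied : ∀ L σ → All (λ u → proj₂ (record-all σ L) (key u) ≢ 0) L
  record-occupied []      σ = []
  record-occupied (u ∷ L) (x , b) =
    record-mono L _ (λ q → 1+n≢0 (trans (sym (update-same b (key u) 1)) q)) ∷ record-occupied L _

  -- The flag never recovers from 0, so no node met an occupied bucket. That the bucket of `v` is
  -- empty after the bucket of `u` was marked separates their keys.
  record-accept : ∀ L σ → proj₁ (record-all σ L) ≢ 0 →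
    proj₁ σ ≢ 0 × All (λ u → proj₂ σ (key u) ≡ 0) L × AllPairs Apart L
  record-accept []      σ p = p , [] , []
  record-accept (u ∷ L) (x , b) p
    with q , es , rs ← record-accept L _ p
    with e , x≢0 ← check-≢0 (b (key u)) q =
    x≢0 , e ∷ All.map (λ {v} e → trans (sym (update-other b 1 (≢-sym (apart v e)))) e) es ,
    All.map (λ {v} → apart v) es ∷ rs
    where
    apart : ∀ v → (b [ key u ↦ 1 ]) (key v) ≡ 0 → key u ≢ key v
    apart v e eq = 1+n≢0 (trans (sym (update-same b (key u) 1)) (trans (cong (b [ key u ↦ 1 ]) eq) e))

  module _ (a : ℕ) (b : ℕ → ℕ) where

    Unmatched : Node d → Set
    Unmatched u = a < proj₁ u → b (key u) ≡ 0

    query-all : ℕ → List (Node d) → ℕ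
    query-all x L = proj₁ (foldl (queryNode h a) (x , b) L)

    query-keep : ∀ L x → All Unmatched L → query-all x L ≡ x
    query-keep []            x []       = refl
    query-keep ((i , v) ∷ L) x (e ∷ es) = trans (query-keep L _ es) (lemma (<-≤-connex a i))
      where
      lemma : a < i ⊎ i ≤ a → checkLate (i ∸ a) (b (h v)) x ≡ x
      lemma (inj₂ i≤a) = cong (λ z → checkLate z (b (h v)) x) (m≤n⇒m∸n≡0 i≤a)
      lemma (inj₁ a<i) rewrite e a<i with i ∸ a
      ... | zero  = refl
      ... | suc _ = refl

    query-accept : ∀ L x → query-all x L ≢ 0 → x ≢ 0 × All Unmatched L
    query-accept []            x p = p , []
    query-accept ((i , v) ∷ L) x p with q , es ← query-accept L _ p
      with i ∸ a in eq
    ... | zero  = q , (λ a<i → contradiction eq (m>n⇒m∸n≢0 a<i)) ∷ es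
    ... | suc _ with e , x≢0 ← check-≢0 (b (h v)) q = x≢0 , (λ _ → e) ∷ es

-- Kruskal rank in terms of dependencies of small weight

Independent≤ : ∀ {d n} → Matrix d n → ℕ → Set
Independent≤ A k = ∀ x → weight x ≤ k → linearCombination x A ≡ 𝟎 → x ≡ 𝟎

module _ {d n : ℕ} (A : Matrix d n) (k : ℕ) where

  -- Independence up to weight k would cover all sets of r + 1 ≤ k columns, against the maximality
  -- of r. The bound k ≤ n is what makes r + 1 an admissible competitor in `largest`.
  rank<⇒¬independent : KruskalRankLessThan A k → k ≤ n → ¬ Independent≤ A k
  rank<⇒¬independent (r , isRank , r<k) k≤n ind =
    1+n≰n (largest (suc r) (≤-trans r<k k≤n) λ S ∣S∣≡ c supp c≡𝟎 j →
      trans (cong (λ x → lookup x j)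
              (ind c (≤-trans (weight-supported c S supp) (≤-trans (≤-reflexive ∣S∣≡) r<k)) c≡𝟎))
            (Vec.lookup-replicate j 0ℙ))
    where open IsKruskalRank isRank

  rank≥⇒independent : KruskalRankAtLeast A k → Independent≤ A k
  rank≥⇒independent (r , isRank , k≤r) x w x≡𝟎
    with S , ∣S∣≡ , supp ← supportingSet x r (≤-trans w k≤r) (IsKruskalRank.bounded isRank) =
    lookup-≡𝟎 (IsKruskalRank.independent isRank S ∣S∣≡ x supp x≡𝟎)

  equal-combinations : Independent≤ A k → ∀ {x y p q} → weight x ≤ p → weight y ≤ q → p + q ≤ k →
    linearCombination x A ≡ linearCombination y A → x ≡ y
  equal-combinations ind {x} {y} wx wy p+q≤k eq =
    ⊕≡𝟎⇒≡ (ind (x ⊕ y) (≤-trans (weight-⊕ x y) (≤-trans (+-mono-≤ wx wy) p+q≤k))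
      (trans (linearCombination-⊕ x y A)
        (trans (cong (_⊕ linearCombination y A) eq) (⊕-self _))))

module Verdict {d n : ℕ} (A : Matrix d n) (h : Column d → ℕ) (k : ℕ) (1≤d : 1 ≤ d) where

  open Main A h k 1≤d using (records; queries)
  open Tables h

  private
    m a : ℕ
    m = ⌈ k /2⌉
    a = ⌊ k /2⌋

    a+m≡k : a + m ≡ k
    a+m≡k = ⌊n/2⌋+⌈n/2⌉≡n k

    ∈-nodes : ∀ {r} x → weight x ≤ r → nodeOf A x ∈ nodes r A
    ∈-nodes {r} x w = subst (nodeOf A x ∈_) (sym (nodes-light r A)) (∈-map⁺ (nodeOf A) (∈-light x w))

  -- Only "equal sums have equal hash values" is used, so this holds for every `h` and yields the
  -- error-free side. The bound k ≤ n is read off from the initial flag.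
  accept⇒independent : proj₁ queries ≢ 0 → k ≤ n × Independent≤ A k
  accept⇒independent p
    with q , unmatched ← query-accept a (proj₂ records) (nodes m A) (proj₁ records) p
    with s , _ , apart ← record-accept (nodes a A) (suc n ∸ k , λ _ → 0) q =
    s≤s⁻¹ (m∸n≢0⇒n<m s) , independent
    where
    -- Either `y` is too heavy to be recorded and was queried against the entry of `z`, or both were
    -- recorded and have different keys unless they are equal.
    coincide : ∀ y z → weight y ≤ m → weight z ≤ a →
               linearCombination y A ≡ linearCombination z A → y ≡ z
    coincide y z wy wz eq with <-≤-connex a (weight y)
    ... | inj₁ a<wy =
      contradiction (All.lookup unmatched (∈-nodes y wy) a<wy)
        (subst (λ v → proj₂ records (h v) ≢ 0) (sym eq)
          (All.lookup (record-occupied (nodes a A) _) (∈-nodes z wz)))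
    ... | inj₂ wy≤a
      with allPairs-∈ (AllPairs.map⁻ (subst (AllPairs Apart) (nodes-light a A) apart))
             (∈-light y wy≤a) (∈-light z wz)
    ...   | inj₁ y≡z        = y≡z
    ...   | inj₂ (inj₁ y≢z) = contradiction (cong h eq) y≢z
    ...   | inj₂ (inj₂ z≢y) = contradiction (cong h (sym eq)) z≢y
    independent : Independent≤ A k
    independent x w x≡𝟎
      with y , z , refl , wy , wz ←
             ⊕-split x m a (≤-trans w (≤-reflexive (sym (trans (+-comm m a) a+m≡k)))) =
      trans (cong (_⊕ z) (coincide y z wy wz
        (⊕≡𝟎⇒≡ (trans (sym (linearCombination-⊕ y z A)) x≡𝟎)))) (⊕-self z)

  independent⇒accept : (∀ {u v} → h u ≡ h v → u ≡ v) → k ≤ n → Independent≤ A k → proj₁ queries ≢ 0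
  independent⇒accept injective k≤n ind p =
    m>n⇒m∸n≢0 (s≤s k≤n) (trans (sym (proj₁ fresh)) (trans (sym kept) p))
    where
    apart : ∀ {x y q} → weight x ≤ a → weight y ≤ q → a + q ≤ k → x ≢ y → Apart (nodeOf A x) (nodeOf A y)
    apart wx wy a+q≤k x≢y eq = x≢y (equal-combinations A k ind wx wy a+q≤k (injective eq))

    pairs : AllPairs Apart (nodes a A)
    pairs = subst (AllPairs Apart) (sym (nodes-light a A))
      (AllPairs.map⁺ (allPairs-with (light-weight a n) (light-unique a n)
        λ {x} {y} wx wy → apart {x} {y} wx wy (≤-trans (+-monoʳ-≤ a (⌊n/2⌋≤⌈n/2⌉ k)) (≤-reflexive a+m≡k))))
      where
      allPairs-with : ∀ {X : Set} {P : X → Set} {Q R : X → X → Set} {xs} → All P xs → AllPairs Q xs →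
        (∀ {x y} → P x → P y → Q x y → R x y) → AllPairs R xs
      allPairs-with []       []       f = []
      allPairs-with (p ∷ ps) (q ∷ qs) f = All.zipWith (λ (p′ , q) → f p p′ q) (ps , q) ∷ allPairs-with ps qs f

    fresh : proj₁ records ≡ suc n ∸ k ×
            (∀ y → All (λ u → y ≢ key u) (nodes a A) → proj₂ records y ≡ 0)
    fresh = record-fresh (nodes a A) (suc n ∸ k) (λ _ → 0) pairs (All.tabulate λ _ → refl)

    unmatched : All (Unmatched a (proj₂ records)) (nodes m A)
    unmatched = subst (All _) (sym (nodes-light m A)) (All.map⁺
      (All.map (λ {y} wy a<wy → proj₂ fresh _ (subst (All _) (sym (nodes-light a A)) (All.map⁺
        (All.map (λ {x} wx eq → apart {x} {y} wx wy (≤-reflexive a+m≡k)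
          -- A queried vector has more than ⌊k/2⌋ ones, so it differs from every recorded one.
          (λ { refl → <⇒≱ a<wy wx }) (sym eq)) (light-weight a n))))) (light-weight m n)))

    kept : proj₁ queries ≡ proj₁ records
    kept = query-keep a (proj₂ records) (nodes m A) (proj₁ records) unmatched

-- Random hash functions

-- Expectations are kept as sums over all hash functions: "probability 1/b" becomes "b times the sum
-- is the number of functions", free of fractions.
total : ∀ {X : Set} → (X → ℕ) → List X → ℕ
total f xs = sum (map f xs)

module _ {X : Set} where

  total-cong : ∀ {f g : X → ℕ} → f ≗ g → ∀ xs → total f xs ≡ total g xs
  total-cong f≗g xs = cong sum (map-cong f≗g xs)

  total-mono : ∀ {f g : X → ℕ} → (∀ x → f x ≤ g x) → ∀ xs → total f xs ≤ total g xs
  total-mono f≤g []       = z≤n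
  total-mono f≤g (x ∷ xs) = +-mono-≤ (f≤g x) (total-mono f≤g xs)

  total-+ : ∀ (f g : X → ℕ) xs → total (λ x → f x + g x) xs ≡ total f xs + total g xs
  total-+ f g []       = refl
  total-+ f g (x ∷ xs) =
    trans (cong (_+_ (f x + g x)) (total-+ f g xs)) (interchange (f x) (g x) (total f xs) (total g xs))
    where
    interchange : ∀ a b c e → a + b + (c + e) ≡ a + c + (b + e)
    interchange = solve-∀

  total-const : ∀ c (xs : List X) → total (λ _ → c) xs ≡ length xs * c
  total-const c []       = refl
  total-const c (x ∷ xs) = cong (_+_ c) (total-const c xs)

  total-* : ∀ c (f : X → ℕ) xs → total (λ x → c * f x) xs ≡ c * total f xs
  total-* c f []       = sym (*-zeroʳ c)
  total-* c f (x ∷ xs) = trans (cong (_+_ (c * f x)) (total-* c f xs)) (sym (*-distribˡ-+ c (f x) (total f xs)))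

  length-total : ∀ (xs : List X) → length xs ≡ total (λ _ → 1) xs
  length-total xs = sym (trans (total-const 1 xs) (*-identityʳ _))

total-cartesianProductWith : ∀ {X Y Z : Set} (f : Z → ℕ) (g : X → Y → Z) xs ys →
  total f (cartesianProductWith g xs ys) ≡ total (λ x → total (λ y → f (g x y)) ys) xs
total-cartesianProductWith f g []       ys = refl
total-cartesianProductWith f g (x ∷ xs) ys = begin
  sum (map f (map (g x) ys ++ cartesianProductWith g xs ys))
    ≡⟨ cong sum (map-++ f (map (g x) ys) _) ⟩
  sum (map f (map (g x) ys) ++ map f (cartesianProductWith g xs ys))
    ≡⟨ sum-++ (map f (map (g x) ys)) _ ⟩
  sum (map f (map (g x) ys)) + total f (cartesianProductWith g xs ys)
    ≡⟨ cong₂ _+_ (cong sum (sym (map-∘ ys))) (total-cartesianProductWith f g xs ys) ⟩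
  total (λ y → f (g x y)) ys + total (λ x → total (λ y → f (g x y)) ys) xs ∎
  where open ≡-Reasoning

indicator : ∀ {p} {P : Set p} → Dec P → ℕ
indicator P? = if does P? then 1 else 0

length-filter-total : ∀ {X : Set} {p} {P : Pred X p} (P? : Decidable P) xs →
                      length (filter P? xs) ≡ total (indicator ∘ P?) xs
length-filter-total P? [] = refl
length-filter-total P? (x ∷ xs) with does (P? x)
... | true  = cong suc (length-filter-total P? xs)
... | false = length-filter-total P? xs

total-tabulate : ∀ {X : Set} {n} (f : X → ℕ) (g : Fin n → X) →
                 total f (tabulate g) ≡ total (f ∘ g) (allFin n)
total-tabulate f g = cong sum (trans (map-tabulate g f) (sym (map-tabulate (λ i → i) (f ∘ g))))

total-allFin-≟ : ∀ {b} (y : Fin b) → total (λ i → indicator (i Fin.≟ y)) (allFin b) ≡ 1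
total-allFin-≟ {suc b} zero =
  cong suc (trans (total-tabulate {n = b} (λ i → indicator (i Fin.≟ zero)) suc)
    (trans (total-const 0 (allFin b)) (*-zeroʳ (length (allFin b)))))
total-allFin-≟ {suc b} (suc y) =
  trans (total-tabulate {n = b} (λ i → indicator (i Fin.≟ suc y)) suc) (total-allFin-≟ y)

indicator-≟-sym : ∀ {b} (x y : Fin b) → indicator (x Fin.≟ y) ≡ indicator (y Fin.≟ x)
indicator-≟-sym x y with x Fin.≟ y | y Fin.≟ x
... | yes _    | yes _   = refl
... | no _     | no _    = refl
... | yes refl | no y≢x  = contradiction refl y≢x
... | no x≢y   | yes y≡x = contradiction (sym y≡x) x≢y

module _ (b : ℕ) where

  size : ℕ → ℕ
  size d = length (hashFunctions d b)

  size-suc : ∀ d → size (suc d) ≡ size d * size d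
  size-suc d = trans (length-total (hashFunctions (suc d) b))
    (trans (total-cartesianProductWith (λ _ → 1) _ (hashFunctions d b) (hashFunctions d b))
      (trans (total-cong (λ _ → sym (length-total (hashFunctions d b))) (hashFunctions d b))
        (total-const (size d) (hashFunctions d b))))

  -- A hash function on d + 1 bits is a pair of independent ones, chosen by the first bit; an event
  -- about one half keeps its probability.
  ignore-second : ∀ d (f : HashFunction d b → ℕ) → b * total f (hashFunctions d b) ≡ size d →
    b * total (λ h₀ → total (λ _ → f h₀) (hashFunctions d b)) (hashFunctions d b) ≡ size (suc d)
  ignore-second d f e = begin
    b * total (λ h₀ → total (λ _ → f h₀) hs) hs ≡⟨ cong (_*_ b) (total-cong (λ h₀ → total-const (f h₀) hs) hs) ⟩
    b * total (λ h₀ → size d * f h₀) hs         ≡⟨ cong (_*_ b) (total-* (size d) f hs) ⟩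
    b * (size d * total f hs)                   ≡⟨ x∙yz≈y∙xz b (size d) (total f hs) ⟩
    size d * (b * total f hs)                   ≡⟨ cong (_*_ (size d)) e ⟩
    size d * size d                             ≡⟨ size-suc d ⟨
    size (suc d)                                ∎
    where
    open ≡-Reasoning
    hs = hashFunctions d b

  -- The law of total probability: conditional probability 1/b for each fixed `h₀` gives 1/b
  -- overall.
  average-second : ∀ d (f : HashFunction d b → HashFunction d b → ℕ) →
    (∀ h₀ → b * total (f h₀) (hashFunctions d b) ≡ size d) →
    b * total (λ h₀ → total (f h₀) (hashFunctions d b)) (hashFunctions d b) ≡ size (suc d)
  average-second d f e = begin
    b * total (λ h₀ → total (f h₀) hs) hs ≡⟨ total-* b _ hs ⟨
    total (λ h₀ → b * total (f h₀) hs) hs ≡⟨ total-cong e hs ⟩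
    total (λ _ → size d) hs               ≡⟨ total-const (size d) hs ⟩
    size d * size d                       ≡⟨ size-suc d ⟨
    size (suc d)                          ∎
    where
    open ≡-Reasoning
    hs = hashFunctions d b

  uniform : ∀ d (v : Column d) (y : Fin b) →
    b * total (λ h → indicator (h v Fin.≟ y)) (hashFunctions d b) ≡ size d
  uniform zero [] y = begin
    b * sum (map _ (map _ (allFin b))) ≡⟨ cong (λ l → b * sum l) (sym (map-∘ (allFin b))) ⟩
    b * total (λ i → indicator (i Fin.≟ y)) (allFin b) ≡⟨ cong (_*_ b) (total-allFin-≟ y) ⟩
    b * 1                              ≡⟨ *-identityʳ b ⟩
    b                                  ≡⟨ length-tabulate {n = b} (λ i → i) ⟨
    length (allFin b)                  ≡⟨ length-map _ (allFin b) ⟨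
    size zero                          ∎
    where open ≡-Reasoning
  uniform (suc d) (0ℙ ∷ v) y =
    trans (cong (_*_ b) (total-cartesianProductWith _ _ (hashFunctions d b) (hashFunctions d b)))
      (ignore-second d (λ h → indicator (h v Fin.≟ y)) (uniform d v y))
  uniform (suc d) (1ℙ ∷ v) y =
    trans (cong (_*_ b) (total-cartesianProductWith _ _ (hashFunctions d b) (hashFunctions d b)))
      (average-second d (λ _ h → indicator (h v Fin.≟ y)) λ _ → uniform d v y)

  -- Vectors with the same first bit are hashed by the same half, which is the induction hypothesis.
  -- Otherwise their values are independent: with `h₀` fixed, `uniform` applies to `h₁`.
  collision : ∀ d (u v : Column d) → u ≢ v →
    b * total (λ h → indicator (h u Fin.≟ h v)) (hashFunctions d b) ≡ size d
  collision zero [] [] u≢v = contradiction refl u≢v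
  collision (suc d) (0ℙ ∷ u) (0ℙ ∷ v) u≢v =
    trans (cong (_*_ b) (total-cartesianProductWith _ _ (hashFunctions d b) (hashFunctions d b)))
      (ignore-second d (λ h → indicator (h u Fin.≟ h v)) (collision d u v (u≢v ∘ cong (0ℙ ∷_))))
  collision (suc d) (0ℙ ∷ u) (1ℙ ∷ v) u≢v =
    trans (cong (_*_ b) (total-cartesianProductWith _ _ (hashFunctions d b) (hashFunctions d b)))
      (average-second d (λ h₀ h₁ → indicator (h₀ u Fin.≟ h₁ v)) λ h₀ →
        trans (cong (_*_ b) (total-cong (λ h₁ → indicator-≟-sym (h₀ u) (h₁ v)) (hashFunctions d b)))
          (uniform d v (h₀ u)))
  collision (suc d) (1ℙ ∷ u) (0ℙ ∷ v) u≢v =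
    trans (cong (_*_ b) (total-cartesianProductWith _ _ (hashFunctions d b) (hashFunctions d b)))
      (average-second d (λ h₀ h₁ → indicator (h₁ u Fin.≟ h₀ v)) λ h₀ → uniform d u (h₀ v))
  collision (suc d) (1ℙ ∷ u) (1ℙ ∷ v) u≢v =
    trans (cong (_*_ b) (total-cartesianProductWith _ _ (hashFunctions d b) (hashFunctions d b)))
      (average-second d (λ _ h → indicator (h u Fin.≟ h v)) λ _ → collision d u v (u≢v ∘ cong (1ℙ ∷_)))

-- The union bound over all pairs of vectors

columnSum : ∀ d → (Column d → ℕ) → ℕ
columnSum zero    f = f []
columnSum (suc d) f = columnSum d (f ∘ (0ℙ ∷_)) + columnSum d (f ∘ (1ℙ ∷_))

columnSum-≡0 : ∀ d f → columnSum d f ≡ 0 → ∀ v → f v ≡ 0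
columnSum-≡0 zero    f e []       = e
columnSum-≡0 (suc d) f e (0ℙ ∷ v) = columnSum-≡0 d _ (m+n≡0⇒m≡0 _ e) v
columnSum-≡0 (suc d) f e (1ℙ ∷ v) = columnSum-≡0 d _ (m+n≡0⇒n≡0 (columnSum d (f ∘ (0ℙ ∷_))) e) v

columnSum-≤ : ∀ c B d f → (∀ v → c * f v ≤ B) → c * columnSum d f ≤ 2 ^ d * B
columnSum-≤ c B zero    f p = ≤-trans (p []) (≤-reflexive (sym (*-identityˡ B)))
columnSum-≤ c B (suc d) f p = begin
  c * (columnSum d _ + columnSum d _)   ≡⟨ *-distribˡ-+ c _ _ ⟩
  c * columnSum d _ + c * columnSum d _ ≤⟨ +-mono-≤ (columnSum-≤ c B d _ (p ∘ (0ℙ ∷_)))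
                                                    (columnSum-≤ c B d _ (p ∘ (1ℙ ∷_))) ⟩
  2 ^ d * B + 2 ^ d * B                 ≡⟨ double (2 ^ d) B ⟩
  2 ^ suc d * B                         ∎
  where
  open ≤-Reasoning
  double : ∀ x B → x * B + x * B ≡ (x + (x + 0)) * B
  double = solve-∀

total-columnSum : ∀ {X : Set} d (f : X → Column d → ℕ) xs →
  total (λ x → columnSum d (f x)) xs ≡ columnSum d (λ v → total (λ x → f x v) xs)
total-columnSum zero    f xs = refl
total-columnSum (suc d) f xs =
  trans (total-+ _ _ xs) (cong₂ _+_ (total-columnSum d (λ x → f x ∘ (0ℙ ∷_)) xs)
                                    (total-columnSum d (λ x → f x ∘ (1ℙ ∷_)) xs))

module _ {d b : ℕ} where

  clash : HashFunction d b → Column d → Column d → ℕ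
  clash h u v = if does (≡-dec ℙ._≟_ u v) then 0 else indicator (h u Fin.≟ h v)

  clashes : HashFunction d b → ℕ
  clashes h = columnSum d λ u → columnSum d λ v → clash h u v

  clash-≡0 : ∀ h {u v} → clash h u v ≡ 0 → h u ≡ h v → u ≡ v
  clash-≡0 h {u} {v} e hu≡hv with ≡-dec ℙ._≟_ u v
  ... | yes u≡v = u≡v
  ... | no _ with h u Fin.≟ h v
  ...   | no hu≢hv = contradiction hu≡hv hu≢hv

  total-clash : ∀ u v → b * total (λ h → clash h u v) (hashFunctions d b) ≤ size b d
  total-clash u v with ≡-dec ℙ._≟_ u v
  ... | yes _   = ≤-trans (≤-reflexive (trans (cong (_*_ b)
                    (trans (total-const 0 (hashFunctions d b)) (*-zeroʳ (size b d)))) (*-zeroʳ b))) z≤n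
  ... | no  u≢v = ≤-reflexive (collision b d u v u≢v)

  -- Linearity of expectation over the 4^d ordered pairs, each clashing with probability at most
  -- 1/b.
  total-clashes : b * total clashes (hashFunctions d b) ≤ 2 ^ d * (2 ^ d * size b d)
  total-clashes = begin
    b * total clashes hs
      ≡⟨ cong (_*_ b) (total-columnSum d (λ h u → columnSum d (clash h u)) hs) ⟩
    b * columnSum d (λ u → total (λ h → columnSum d (clash h u)) hs)
      ≤⟨ columnSum-≤ b _ d _ (λ u → ≤-trans
           (≤-reflexive (cong (_*_ b) (total-columnSum d (λ h → clash h u) hs)))
           (columnSum-≤ b _ d _ (total-clash u))) ⟩
    2 ^ d * (2 ^ d * size b d) ∎
    where
    open ≤-Reasoning
    hs = hashFunctions d b

  module _ {p} {P : Pred (HashFunction d b) p} (P? : Decidable P)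
           (good : ∀ h → (∀ {u v} → h u ≡ h v → u ≡ v) → P h) where

    private
      favourable : ℕ
      favourable = length (filter P? (hashFunctions d b))

    -- The first-moment bound: a function outside `P` is not injective and therefore has at least
    -- one clash.
    size-≤ : size b d ≤ favourable + total clashes (hashFunctions d b)
    size-≤ = begin
      size b d                                                       ≡⟨ length-total hs ⟩
      total (λ _ → 1) hs                                             ≤⟨ total-mono covered hs ⟩
      total (λ h → indicator (P? h) + clashes h) hs                  ≡⟨ total-+ _ _ hs ⟩
      total (indicator ∘ P?) hs + total clashes hs                   ≡⟨ cong (_+ total clashes hs) (length-filter-total P? hs) ⟨
      favourable + total clashes hs                                  ∎
      where
      open ≤-Reasoning
      hs = hashFunctions d b
      covered : ∀ h → 1 ≤ indicator (P? h) + clashes h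
      covered h with P? h
      ... | yes _ = s≤s z≤n
      ... | no ¬Ph with clashes h in e
      ...   | suc _ = s≤s z≤n
      ...   | zero = contradiction (good h λ {u} {v} →
                clash-≡0 h (columnSum-≡0 d _ (columnSum-≡0 d _ e u) v)) ¬Ph

    -- b (size − favourable) ≤ 4^d size ≤ b size / 128, without subtraction and division.
    favourable-≥ : 128 * 4 ^ d ≤ b → 99 * size b d ≤ favourable * 100
    favourable-≥ large = *-cancelˡ-≤ 128 (begin
      128 * (99 * N)       ≡⟨ *-assoc 128 99 N ⟨
      -- Here 128 · 99 = 12672 and 127 · 100 = 12700, that is, 99/100 ≤ 127/128.
      12672 * N            ≤⟨ *-monoˡ-≤ N (m≤m+n 12672 28) ⟩
      12700 * N            ≡⟨ eq₁ N ⟩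
      127 * N * 100        ≤⟨ *-monoˡ-≤ 100 most ⟩
      128 * F * 100        ≡⟨ *-assoc 128 F 100 ⟩
      128 * (F * 100)      ∎)
      where
      open ≤-Reasoning
      N F T : ℕ
      N = size b d
      F = favourable
      T = total clashes (hashFunctions d b)
      eq₁ : ∀ N → 12700 * N ≡ 127 * N * 100
      eq₁ = solve-∀
      eq₂ : ∀ b N → b * (127 * N) + b * N ≡ 128 * (b * N)
      eq₂ = solve-∀
      eq₃ : ∀ b F T → 128 * (b * (F + T)) ≡ b * (128 * F) + 128 * (b * T)
      eq₃ = solve-∀
      eq₄ : ∀ x N → 128 * (x * (x * N)) ≡ 128 * (x * x) * N
      eq₄ = solve-∀
      square : 2 ^ d * 2 ^ d ≡ 4 ^ d
      square = trans (sym (^-distribˡ-+-* 2 d d))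
        (trans (cong (λ e → 2 ^ (d + e)) (sym (+-identityʳ d))) (sym (^-*-assoc 2 2 d)))
      instance
        b≢0 : NonZero b
        b≢0 = >-nonZero (≤-trans (≤-trans (s≤s z≤n) (*-monoʳ-≤ 128 (m^n>0 4 d))) large)
      most : 127 * N ≤ 128 * F
      most = *-cancelˡ-≤ b (+-cancelʳ-≤ (b * N) _ _ (begin
        b * (127 * N) + b * N                    ≡⟨ eq₂ b N ⟩
        128 * (b * N)                            ≤⟨ *-monoʳ-≤ 128 (*-monoʳ-≤ b size-≤) ⟩
        128 * (b * (F + T))                      ≡⟨ eq₃ b F T ⟩
        b * (128 * F) + 128 * (b * T)            ≤⟨ +-monoʳ-≤ (b * (128 * F)) (*-monoʳ-≤ 128 total-clashes) ⟩
        b * (128 * F) + 128 * (2 ^ d * (2 ^ d * N)) ≡⟨ cong (_+_ (b * (128 * F))) (eq₄ (2 ^ d) N) ⟩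
        b * (128 * F) + 128 * (2 ^ d * 2 ^ d) * N ≡⟨ cong (λ x → b * (128 * F) + 128 * x * N) square ⟩
        b * (128 * F) + 128 * 4 ^ d * N          ≤⟨ +-monoʳ-≤ (b * (128 * F)) (*-monoˡ-≤ N large) ⟩
        b * (128 * F) + b * N                    ∎))

    probability-≥ : .{{_ : NonZero b}} → 128 * 4 ^ d ≤ b → (+ 99 / 100) ≤ℚ Probability P?
    probability-≥ large = ratio {{hashFunctions-nonEmpty d b}} (favourable-≥ large)
      where
      ratio : ∀ {c N} .{{_ : NonZero N}} → 99 * N ≤ c * 100 → (+ 99 / 100) ≤ℚ (+ c / N)
      ratio {c} {suc N} le = *≤* (subst₂ ℤ._≤_ (ℤ.pos-* 99 (suc N)) (ℤ.pos-* c 100) (ℤ.+≤+ le))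

-- Running time and verdict of the algorithm

report-zero : ∀ {d} (s : State d) → (num s 0 ≢ 0 → num s 0 ≡ 0) → report s ≡ rank<k
report-zero s p with num s 0
... | zero  = refl
... | suc _ with () ← p (λ ())

report-nonzero : ∀ {d} (s : State d) → num s 0 ≢ 0 → report s ≡ rank≥k
report-nonzero s p with num s 0
... | zero  = contradiction refl p
... | suc _ = refl

module _ {d n k : ℕ} (1≤d : 1 ≤ d) (1≤n : 1 ≤ n) (1≤k : 1 ≤ k) (A : Matrix d n) where

  private
    module S = Running A nothing
    open Setup A k using (setup-run)
    open S.Run setup-run using () renaming
      (reached to s₀; execution to x₀; duration≤ to t₀; reached≈ to e₀; postcondition to p₀)

    b₀≡ : num s₀ 0 ≡ 128 * 4 ^ d
    b₀≡ = trans (num≗ e₀ 0) (cong (λ s → num s 0) (sym p₀))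

    mainRun : (h : Column d → ℕ) → Running.Run A (just h) mainProgram s₀ _ _
    mainRun h = Running.Run-≈ A (just h) (≈-sym (subst (s₀ ≈_) (sym p₀) e₀))
                  (Main.main-run A h k 1≤d _)

    module M (h : Column d → ℕ) = Running.Run (mainRun h)

  behaviour : Behaviour (record { setup = setupProgram ; main = mainProgram }) k A
  behaviour = record
    { setupTime       = _
    ; afterSetup      = s₀
    ; runSetup        = x₀
    ; buckets-nonZero = subst NonZero (sym b₀≡) (m*n≢0 128 (4 ^ d) {{_}} {{m^n≢0 4 d}})
    ; mainTime        = λ h → M.duration (toℕ ∘ h)
    ; final           = λ h → M.reached (toℕ ∘ h)
    ; runMain         = λ h → M.execution (toℕ ∘ h)
    }

  open Behaviour behaviour

  flag-final : ∀ h → num (final h) 0 ≡ proj₁ (Main.queries A (toℕ ∘ h) k 1≤d)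
  flag-final h = trans (num≗ (M.reached≈ (toℕ ∘ h)) 0) (M.postcondition (toℕ ∘ h))

  private
    U : ℕ
    U = d * k * n ^ ⌈ k /2⌉

    instance
      d≢0 : NonZero d
      d≢0 = >-nonZero 1≤d
      n≢0 : NonZero n
      n≢0 = >-nonZero 1≤n
      buckets≢0 : NonZero buckets
      buckets≢0 = buckets-nonZero
      power≢0 : NonZero (n ^ ⌈ k /2⌉)
      power≢0 = m^n≢0 n ⌈ k /2⌉

    d*-≤U : ∀ x → x ≤ k * n ^ ⌈ k /2⌉ → d * x ≤ U
    d*-≤U x le = ≤-trans (*-monoʳ-≤ d le) (≤-reflexive (sym (*-assoc d k _)))

    k≤kP : k ≤ k * n ^ ⌈ k /2⌉
    k≤kP = m≤m*n k _

    d≤U : d ≤ U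
    d≤U = ≤-trans (≤-reflexive (sym (*-identityʳ d))) (d*-≤U 1 (≤-trans 1≤k k≤kP))

    k≤U : k ≤ U
    k≤U = ≤-trans (m≤n*m k d) (d*-≤U k k≤kP)

    walk≤ : ∀ r → r ≤ ⌈ k /2⌉ → length (nodes r A) * (32 * d) ≤ 64 * U
    walk≤ r r≤m = begin
      length (nodes r A) * (32 * d)      ≤⟨ *-monoˡ-≤ (32 * d) (length-nodes r A) ⟩
      suc (r * n ^ r) * (32 * d)         ≡⟨ lemma d (r * n ^ r) ⟩
      32 * d + 32 * (d * (r * n ^ r))    ≤⟨ +-mono-≤ (*-monoʳ-≤ 32 d≤U) (*-monoʳ-≤ 32 (d*-≤U _
                                              (*-mono-≤ (≤-trans r≤m (⌈n/2⌉≤n k)) (^-monoʳ-≤ n r≤m)))) ⟩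
      32 * U + 32 * U                    ≡⟨ *-distribʳ-+ U 32 32 ⟨
      64 * U                             ∎
      where
      open ≤-Reasoning
      lemma : ∀ d x → suc x * (32 * d) ≡ 32 * d + 32 * (d * x)
      lemma = solve-∀

  time-≤ : ∀ h → time h ≤ 151 * U
  time-≤ h = begin
    time h
      ≤⟨ +-mono-≤ t₀ (M.duration≤ (toℕ ∘ h)) ⟩
    3 + (d * 4 + 1) + (1 + (k * 6 + 1 + ((4 + d) + ((1 + V₁) + (1 + V₂)))))
      ≡⟨ lemma d k V₁ V₂ ⟩
    -- Every term is charged to `U`: 4 d for the quadruplings and d for a clear, 6 k for the halving
    -- loop, and 64 `U` per search, 32 each for the two summands of 1 + r n^r.
    12 * 1 + (5 * d + (6 * k + (V₁ + V₂)))
      ≤⟨ +-mono-≤ (*-monoʳ-≤ 12 (≤-trans 1≤d d≤U)) (+-mono-≤ (*-monoʳ-≤ 5 d≤U)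
           (+-mono-≤ (*-monoʳ-≤ 6 k≤U)
             (+-mono-≤ (walk≤ ⌊ k /2⌋ (⌊n/2⌋≤⌈n/2⌉ k)) (walk≤ ⌈ k /2⌉ ≤-refl)))) ⟩
    12 * U + (5 * U + (6 * U + (64 * U + 64 * U)))
      ≡⟨ lemma′ U ⟩
    151 * U ∎
    where
    open ≤-Reasoning
    V₁ V₂ : ℕ
    V₁ = length (nodes ⌊ k /2⌋ A) * (32 * d)
    V₂ = length (nodes ⌈ k /2⌉ A) * (32 * d)
    lemma : ∀ d k v w → 3 + (d * 4 + 1) + (1 + (k * 6 + 1 + ((4 + d) + ((1 + v) + (1 + w)))))
                      ≡ 12 * 1 + (5 * d + (6 * k + (v + w)))
    lemma = solve-∀
    lemma′ : ∀ u → 12 * u + (5 * u + (6 * u + (64 * u + 64 * u))) ≡ 151 * u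
    lemma′ = solve-∀

  low-rank : KruskalRankLessThan A k → ∀ h → outcome h ≡ rank<k
  low-rank low h = report-zero (final h) λ accepted →
    let k≤n , ind = Verdict.accept⇒independent A (toℕ ∘ h) k 1≤d (accepted ∘ trans (flag-final h)) in
    contradiction ind (rank<⇒¬independent A k low k≤n)

  high-rank : KruskalRankAtLeast A k → (+ 99 / 100) ≤ℚ Probability (λ h → outcome h ≟ᴿ rank≥k)
  high-rank high@(r , isRank , k≤r) = probability-≥ (λ h → outcome h ≟ᴿ rank≥k)
    (λ h injective → report-nonzero (final h) λ rejected →
      Verdict.independent⇒accept A (toℕ ∘ h) k 1≤d (injective ∘ toℕ-injective)
        (≤-trans k≤r (IsKruskalRank.bounded isRank)) (rank≥⇒independent A k high)
        (trans (sym (flag-final h)) rejected))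
    (≤-reflexive (sym b₀≡))

lemma5 : Σ[ 𝒜 ∈ Algorithm ] Σ[ C ∈ ℕ ]
    (∀ (d n k : ℕ) → 1 ≤ d → 1 ≤ n → 1 ≤ k → (A : Matrix d n) →
    Σ[ R ∈ Behaviour 𝒜 k A ]
    let open Behaviour R in
    (∀ h → time h ≤ C * (d * k * n ^ ⌈ k /2⌉))
    × (KruskalRankLessThan A k → ∀ h → outcome h ≡ rank<k)
    × (KruskalRankAtLeast A k →
    (+ 99 / 100) ≤ℚ Probability (λ h → outcome h ≟ᴿ rank≥k)))
lemma5 = record { setup = setupProgram ; main = mainProgram } , 151 , λ d n k 1≤d 1≤n 1≤k A →
  behaviour 1≤d 1≤n 1≤k A , time-≤ 1≤d 1≤n 1≤k A , low-rank 1≤d 1≤n 1≤k A , high-rank 1≤d 1≤n 1≤k A
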